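{- Let $q \geq 2$ and let $n, r$ be positive integers with $r \leq n-1$. Let $P_{n,q}$ be the probability measure on partitions of $n$ given by \[ P_{n,q}(\lambda) = \frac{q^n (\frac{1}{q})_n}{\prod_{j \geq 1} q^{(\lambda_j')^2} (\frac{1}{q})_{m_j(\lambda)}}, \] and let $P_{n,q}^r$ be the $P_{n,q}$-probability that $\lambda_1 < r$. Then \begin{enumerate} \item $P_{n,q}^r \leq \left(\frac{1}{1-1/q}\right)^2 \left[\frac{1}{q^{2n-2r+2}} + \frac{1}{1-1/q^{2n+1}} \cdot \frac{1}{q^{n+1}}\right]$; \item $P_{n,q}^r \geq \frac{1}{q^{2n-2r+2}} - \frac{1}{q^{n+1}(1-1/q)} - \frac{1}{q^{2n-2r+3}(1-1/q)^2} - \frac{1}{q^{3n-3r+4}(1-1/q)^3} - \frac{1}{(1-1/q)^2}\cdot\frac{1}{q^{2n+3}(1-1/q^{2n+3})}$. \end{enumerate}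
   Context: For a partition $\lambda$, $\lambda_1$ is its largest part, $m_i(\lambda)$ the number of parts equal to $i$, and $\lambda'$ the transpose partition with $\lambda_i' = m_i(\lambda)+m_{i+1}(\lambda)+\cdots$. Notation: $(x)_n = (1-x)(1-x/q)\cdots(1-x/q^{n-1})$, so $(1/q)_n = \prod_{i=1}^n(1-1/q^i)$.
   Formalization: The parameter q ≥ 2 is taken to be a rational number rather than an arbitrary real number. -}

module Defs where

open import Data.Nat as ℕ using (ℕ; zero; suc; _≡ᵇ_; _<ᵇ_; _⊔_)
open import Data.Fin using (Fin; toℕ)
open import Data.Vec using (Vec; []; _∷_; lookup; tabulate; toList)
open import Data.List using (List; []; _∷_; map; concatMap; upTo; foldr)
open import Data.Nat.ListAction using (sum)
open import Data.Bool using (Bool; true; false; if_then_else_; _∧_)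
open import Data.Rational using (ℚ; 0ℚ; 1ℚ; _+_; _*_; _-_; 1/_; ≢-nonZero)
open import Data.Rational.Properties using (_≟_)
open import Relation.Nullary using (yes; no)

-- Total inverse on ℚ (inv 0 = 0); only applied to nonzero arguments below.
inv : ℚ → ℚ
inv p with p ≟ 0ℚ
... | yes _ = 0ℚ
... | no p≢0 = 1/_ p {{≢-nonZero p≢0}}

_^_ : ℚ → ℕ → ℚ
x ^ zero = 1ℚ
x ^ suc k = x * (x ^ k)

fromℕ : ℕ → ℚ
fromℕ n = Data.Rational._/_ (Data.Integer.+_ n) 1
  where import Data.Integer

sumℚ : List ℚ → ℚ
sumℚ = foldr _+_ 0ℚ

prodℚ : List ℚ → ℚ
prodℚ = foldr _*_ 1ℚ

-- (x)_k = (1-x)(1-x/q)...(1-x/q^{k-1}); we only need (1/q)_k = ∏_{i=1}^k (1 - 1/q^i)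
poch1/q : ℚ → ℕ → ℚ
poch1/q q zero = 1ℚ
poch1/q q (suc k) = poch1/q q k * (1ℚ - inv (q ^ suc k))

-- A partition λ of n is encoded by its multiplicity vector
-- m : Vec ℕ n, where lookup m i = m_{i+1}(λ) (parts are ≤ n).
-- All vectors of length k with entries in {0,…,b}:
allVecs : (k b : ℕ) → List (Vec ℕ k)
allVecs zero b = [] ∷ []
allVecs (suc k) b = concatMap (λ v → map (λ a → a ∷ v) (upTo (suc b))) (allVecs k b)

size : ∀ {n} → Vec ℕ n → ℕ
size {n} m = sum (toList (tabulate (λ (i : Fin n) → suc (toℕ i) ℕ.* lookup m i)))

largest : ∀ {n} → Vec ℕ n → ℕ
largest {n} m = foldr _⊔_ 0 (toList (tabulate (λ (i : Fin n) → if lookup m i ≡ᵇ 0 then 0 else suc (toℕ i))))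

conj : ∀ {n} → Vec ℕ n → ℕ → ℕ
conj {n} m j = sum (toList (tabulate (λ (i : Fin n) → if suc (toℕ i) <ᵇ j then 0 else lookup m i)))

-- P_{n,q}(λ) = q^n (1/q)_n / ∏_{j≥1} q^{(λ'_j)^2} (1/q)_{m_j(λ)}
-- (factors with j > n equal 1, since λ'_j = m_j = 0 there)
Pnq : (n : ℕ) → ℚ → Vec ℕ n → ℚ
Pnq n q m = ((q ^ n) * poch1/q q n) *
  inv (prodℚ (toList (tabulate (λ (i : Fin n) →
        (q ^ (conj m (suc (toℕ i)) ℕ.* conj m (suc (toℕ i)))) * poch1/q q (lookup m i)))))

Pr : (n r : ℕ) → ℚ → ℚ
Pr n r q = sumℚ (map (λ m → if (size m ≡ᵇ n) ∧ (largest m <ᵇ r) then Pnq n q m else 0ℚ) (allVecs n n))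

{-# OPTIONS --safe #-}
-- Weight a partition λ by x^(Σ λ'_j²) / ∏ (x;x)_{m_j} with x = 1/q.  Removing the first column gives a
-- recursion for the total weight of the partitions of n with s parts, and q-Vandermonde solves it: all
-- partitions of n together weigh x^n / (x;x)_n.  Putting a new first row of length l on top of a partition
-- of n − l with parts at most l multiplies the weight by x^(2n−l) and by a factor that is at least 1, and
-- equal to 1/(1−x) if n − l < l.  So λ₁ = l has a known probability for 2l > n and a lower bound for
-- 2l = n.  Subtracting these from the total for all l ≥ r bounds P(λ₁ < r) from above, after replacing r by
-- ⌈n/2⌉ if it is smaller.  For the lower bound λ₁ = r − 1 alone is enough; if 2(r − 1) < n, the claimed bound
-- is not positive.
module Submission where

open import Defs
open import Data.Bool using (Bool; true; false; if_then_else_; _∧_)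
import Data.Bool.Properties as Bool
open import Data.Fin using (Fin; zero; suc; toℕ)
open import Data.List using (List; []; _∷_; _++_; map; concatMap; applyUpTo; upTo; foldr)
open import Data.List.Properties using (map-++)
open import Data.Nat as ℕ using (ℕ; zero; suc; _+_; _*_; _∸_; _<_; z≤n; s≤s; _≡ᵇ_; _<ᵇ_; _⊔_)
open import Data.Nat.ListAction using (sum)
import Data.Nat.Properties as ℕ
import Data.Nat.Solver as ℕ
open import Data.Product using (_×_; _,_; proj₁; ∃-syntax)
open import Data.Rational as ℚ using (ℚ; 0ℚ; 1ℚ; _≤_; _-_; -_; nonNegative; positive)
  renaming (_+_ to _+ℚ_; _*_ to _*ℚ_)
import Data.Rational.Properties as ℚ
open import Data.Rational.Solver using (module +-*-Solver)
open import Data.Sum using (_⊎_; inj₁; inj₂)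
open import Data.Vec using (Vec; []; _∷_; lookup; tabulate; toList)
open import Function using (_∘_; id)
open import Relation.Binary.PropositionalEquality
  using (_≡_; _≢_; refl; sym; trans; cong; cong₂; subst; subst₂; module ≡-Reasoning)
open import Relation.Nullary using (yes; no; contradiction)
open import Relation.Nullary.Decidable using (dec-true; dec-false)
open +-*-Solver using (solve; _:+_; _:*_; _:-_; :-_; _:=_; con)
private module NS = ℕ.+-*-Solver

-- A new first row of length l lengthens l columns by one, so the sum of the λ'_j² grows by 2(n - l)
-- + l, and (x;x)_{m_l} gains the factor 1 - x^(m_l + 1), which is 1 - x exactly when l did not
-- occur before. The recursion removes columns rather than rows, so this comparison is proved by
-- stripping columns from both partitions until the new row has length 1. The subtraction behind the
-- upper bound is a near cancellation. Let u = 1/(1 - x) and M = n - r. For large r the partitions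
-- with λ₁ ≥ r weigh at least x^n (1 + u x^(M+1)) / (x;x)_M, and (x;x)_n / (x;x)_M is at least 1 - u
-- x^(M+1). The first-order terms cancel and u² x^(2M+2) remains: hence the square of 1/(1 - 1/q)
-- and the exponent 2n - 2r + 2. At r = ⌈n/2⌉ the bound has become u² x^(n+1), hence the other
-- summand.

-- Order, inverses and powers in ℚ

≤-from-gap : ∀ {a b} d → 0ℚ ≤ d → b ≡ a +ℚ d → a ≤ b
≤-from-gap {a} {b} d 0≤d eq = subst₂ _≤_ (ℚ.+-identityʳ a) (sym eq) (ℚ.+-monoʳ-≤ a 0≤d)

-- Known inequalities enter an explicit difference as nonnegative summands of this form, so an
-- estimate reduces to a ring identity and `≤-from-gap`.
gap : ∀ {a b} → a ≤ b → 0ℚ ≤ b - a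
gap {a} {b} a≤b = subst (_≤ b - a) (ℚ.+-inverseʳ a) (ℚ.+-monoˡ-≤ (- a) a≤b)

0≤+ : ∀ {a b} → 0ℚ ≤ a → 0ℚ ≤ b → 0ℚ ≤ a +ℚ b
0≤+ {a} {b} 0≤a 0≤b = ℚ.≤-trans 0≤a (≤-from-gap b 0≤b refl)

*-monoʳ : ∀ {a b c} → 0ℚ ≤ c → a ≤ b → c *ℚ a ≤ c *ℚ b
*-monoʳ {c = c} 0≤c = ℚ.*-monoˡ-≤-nonNeg c {{nonNegative 0≤c}}

0≤* : ∀ {a b} → 0ℚ ≤ a → 0ℚ ≤ b → 0ℚ ≤ a *ℚ b
0≤* {a} {b} 0≤a 0≤b = subst (_≤ a *ℚ b) (ℚ.*-zeroʳ a) (*-monoʳ 0≤a 0≤b)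

0<* : ∀ {a b} → 0ℚ ℚ.< a → 0ℚ ℚ.< b → 0ℚ ℚ.< a *ℚ b
0<* {a} {b} 0<a 0<b =
  ℚ.positive⁻¹ (a *ℚ b) {{ℚ.pos*pos⇒pos a {{positive 0<a}} b {{positive 0<b}}}}

0<1 : 0ℚ ℚ.< 1ℚ
0<1 = ℚ.positive⁻¹ 1ℚ

0≤1 : 0ℚ ≤ 1ℚ
0≤1 = ℚ.<⇒≤ 0<1

*-inv : ∀ {p} → 0ℚ ℚ.< p → p *ℚ inv p ≡ 1ℚ
*-inv {p} 0<p with p ℚ.≟ 0ℚ
... | yes p≡0 = contradiction (sym p≡0) (ℚ.<⇒≢ 0<p)
... | no  p≢0 = ℚ.*-inverseʳ p {{ℚ.≢-nonZero p≢0}}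

inv-unique : ∀ {p} r → 0ℚ ℚ.< p → p *ℚ r ≡ 1ℚ → inv p ≡ r
inv-unique {p} r 0<p pr≡1 = begin
  inv p                ≡⟨ ℚ.*-identityʳ (inv p) ⟨
  inv p *ℚ 1ℚ          ≡⟨ cong (inv p *ℚ_) pr≡1 ⟨
  inv p *ℚ (p *ℚ r)    ≡⟨ solve 3 (λ a b c → a :* (b :* c) := (b :* a) :* c) refl (inv p) p r ⟩
  (p *ℚ inv p) *ℚ r    ≡⟨ cong (_*ℚ r) (*-inv 0<p) ⟩
  1ℚ *ℚ r              ≡⟨ ℚ.*-identityˡ r ⟩
  r                    ∎
  where open ≡-Reasoning

0<inv : ∀ {p} → 0ℚ ℚ.< p → 0ℚ ℚ.< inv p
0<inv {p} 0<p with p ℚ.≟ 0ℚ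
... | yes p≡0 = contradiction (sym p≡0) (ℚ.<⇒≢ 0<p)
... | no  p≢0 = ℚ.positive⁻¹ _ {{ℚ.1/pos⇒pos p {{positive 0<p}}}}

inv-* : ∀ {p r} → 0ℚ ℚ.< p → 0ℚ ℚ.< r → inv (p *ℚ r) ≡ inv p *ℚ inv r
inv-* {p} {r} 0<p 0<r = inv-unique (inv p *ℚ inv r) (0<* 0<p 0<r) (begin
  (p *ℚ r) *ℚ (inv p *ℚ inv r)
    ≡⟨ solve 4 (λ p r p' r' → (p :* r) :* (p' :* r') := (p :* p') :* (r :* r')) refl p r (inv p) (inv r) ⟩
  (p *ℚ inv p) *ℚ (r *ℚ inv r)
    ≡⟨ cong₂ _*ℚ_ (*-inv 0<p) (*-inv 0<r) ⟩
  1ℚ ∎)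
  where open ≡-Reasoning

^-+ : ∀ p a b → p ^ (a + b) ≡ p ^ a *ℚ p ^ b
^-+ p zero    b = sym (ℚ.*-identityˡ _)
^-+ p (suc a) b = trans (cong (p *ℚ_) (^-+ p a b)) (sym (ℚ.*-assoc p _ _))

0<^ : ∀ {p} → 0ℚ ℚ.< p → ∀ k → 0ℚ ℚ.< p ^ k
0<^ 0<p zero    = 0<1
0<^ 0<p (suc k) = 0<* 0<p (0<^ 0<p k)

inv-^ : ∀ {p} → 0ℚ ℚ.< p → ∀ k → inv (p ^ k) ≡ inv p ^ k
inv-^ 0<p zero    = refl
inv-^ {p} 0<p (suc k) = trans (inv-* 0<p (0<^ 0<p k)) (cong (inv p *ℚ_) (inv-^ 0<p k))

-- Finite sums

∑ : ℕ → (ℕ → ℚ) → ℚ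
∑ zero    f = 0ℚ
∑ (suc K) f = f 0 +ℚ ∑ K (f ∘ suc)

∑-cong : ∀ K {f g} → (∀ j → j < K → f j ≡ g j) → ∑ K f ≡ ∑ K g
∑-cong zero    eq = refl
∑-cong (suc K) eq = cong₂ _+ℚ_ (eq 0 (s≤s z≤n)) (∑-cong K λ j j<K → eq (suc j) (s≤s j<K))

∑-mono : ∀ K {f g} → (∀ j → f j ≤ g j) → ∑ K f ≤ ∑ K g
∑-mono zero    le = ℚ.≤-refl
∑-mono (suc K) le = ℚ.+-mono-≤ (le 0) (∑-mono K (le ∘ suc))

∑-zero : ∀ K {f} → (∀ j → j < K → f j ≡ 0ℚ) → ∑ K f ≡ 0ℚ
∑-zero zero    eq = refl
∑-zero (suc K) eq = cong₂ _+ℚ_ (eq 0 (s≤s z≤n)) (∑-zero K λ j j<K → eq (suc j) (s≤s j<K))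

∑-nonneg : ∀ K {f} → (∀ j → 0ℚ ≤ f j) → 0ℚ ≤ ∑ K f
∑-nonneg zero    0≤f = ℚ.≤-refl
∑-nonneg (suc K) 0≤f = 0≤+ (0≤f 0) (∑-nonneg K (0≤f ∘ suc))

∑-+ : ∀ K f g → ∑ K (λ j → f j +ℚ g j) ≡ ∑ K f +ℚ ∑ K g
∑-+ zero    f g = refl
∑-+ (suc K) f g = trans (cong (f 0 +ℚ g 0 +ℚ_) (∑-+ K _ _))
  (solve 4 (λ a b c d → a :+ b :+ (c :+ d) := a :+ c :+ (b :+ d)) refl (f 0) (g 0) _ _)

∑-* : ∀ K c f → ∑ K (λ j → c *ℚ f j) ≡ c *ℚ ∑ K f
∑-* zero    c f = sym (ℚ.*-zeroʳ c)
∑-* (suc K) c f = trans (cong (c *ℚ f 0 +ℚ_) (∑-* K c _)) (sym (ℚ.*-distribˡ-+ c _ _))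

∑-snoc : ∀ K f → ∑ (suc K) f ≡ ∑ K f +ℚ f K
∑-snoc zero    f = ℚ.+-comm (f 0) 0ℚ
∑-snoc (suc K) f = trans (cong (f 0 +ℚ_) (∑-snoc K (f ∘ suc))) (sym (ℚ.+-assoc (f 0) _ _))

-- The index shift behind summation with Pascal's rule: `h` collects the part of each term that
-- belongs to the previous index, and `h M ≡ 0ℚ` lets both sums have the same range.
∑-pascal : ∀ M f g h → f 0 ≡ g 0 → (∀ j → f (suc j) ≡ g (suc j) +ℚ h j) → h M ≡ 0ℚ →
  ∑ (suc M) f ≡ ∑ (suc M) (λ j → g j +ℚ h j)
∑-pascal M f g h f₀ fₛ h≡0 = begin
  f 0 +ℚ ∑ M (f ∘ suc)                        ≡⟨ cong₂ _+ℚ_ f₀ (∑-cong M λ j _ → fₛ j) ⟩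
  g 0 +ℚ ∑ M (λ j → g (suc j) +ℚ h j)         ≡⟨ cong (g 0 +ℚ_) (∑-+ M (g ∘ suc) h) ⟩
  g 0 +ℚ (∑ M (g ∘ suc) +ℚ ∑ M h)             ≡⟨ solve 3 (λ a b c → a :+ (b :+ c) := (a :+ b) :+ (c :+ con 0ℚ)) refl (g 0) (∑ M (g ∘ suc)) (∑ M h) ⟩
  ∑ (suc M) g +ℚ (∑ M h +ℚ 0ℚ)                ≡⟨ cong (λ z → ∑ (suc M) g +ℚ (∑ M h +ℚ z)) h≡0 ⟨
  ∑ (suc M) g +ℚ (∑ M h +ℚ h M)               ≡⟨ cong (∑ (suc M) g +ℚ_) (∑-snoc M h) ⟨
  ∑ (suc M) g +ℚ ∑ (suc M) h                  ≡⟨ ∑-+ (suc M) g h ⟨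
  ∑ (suc M) (λ j → g j +ℚ h j)                ∎
  where open ≡-Reasoning

-- Gaussian binomials and q-Vandermonde

φ : ℚ → ℕ → ℚ
φ x zero    = 1ℚ
φ x (suc k) = φ x k *ℚ (1ℚ - x ^ suc k)

-- The Gaussian binomial coefficient [N choose j] in base x.
B : ℚ → ℕ → ℕ → ℚ
B x N       zero    = 1ℚ
B x zero    (suc j) = 0ℚ
B x (suc N) (suc j) = x ^ suc j *ℚ B x N (suc j) +ℚ B x N j

B-> : ∀ x {N j} → N < j → B x N j ≡ 0ℚ
B-> x {zero}  {suc j} _         = refl
B-> x {suc N} {suc j} (s≤s N<j) = trans
  (cong₂ (λ u v → x ^ suc j *ℚ u +ℚ v) (B-> x (ℕ.m<n⇒m<1+n N<j)) (B-> x N<j))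
  (trans (ℚ.+-identityʳ _) (ℚ.*-zeroʳ (x ^ suc j)))

B-diag : ∀ x N → B x N N ≡ 1ℚ
B-diag x zero    = refl
B-diag x (suc N) = trans
  (cong₂ (λ u v → x ^ suc N *ℚ u +ℚ v) (B-> x (ℕ.n<1+n N)) (B-diag x N))
  (cong (_+ℚ 1ℚ) (ℚ.*-zeroʳ (x ^ suc N)))

-- The quotient formula for Gaussian binomials, free of division. Pascal's rule brings in two
-- smaller instances, which recombine by X(1 - Y) + (1 - X) = 1 - XY.
B-φ : ∀ x u v → B x (u + v) u *ℚ (φ x u *ℚ φ x v) ≡ φ x (u + v)
B-φ x zero    v = trans (ℚ.*-identityˡ _) (ℚ.*-identityˡ _)
B-φ x (suc u) zero rewrite ℕ.+-identityʳ u | B-diag x (suc u) =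
  trans (ℚ.*-identityˡ _) (ℚ.*-identityʳ _)
B-φ x (suc u) (suc v) = begin
  (X *ℚ b₁ +ℚ b₀) *ℚ ((φ x u *ℚ (1ℚ - X)) *ℚ (φ x v *ℚ (1ℚ - Y)))
    ≡⟨ solve 6 (λ X Y b₁ b₀ f g → (X :* b₁ :+ b₀) :* ((f :* (con 1ℚ :- X)) :* (g :* (con 1ℚ :- Y)))
         := X :* (con 1ℚ :- Y) :* (b₁ :* ((f :* (con 1ℚ :- X)) :* g)) :+ (con 1ℚ :- X) :* (b₀ :* (f :* (g :* (con 1ℚ :- Y)))))
         refl X Y b₁ b₀ (φ x u) (φ x v) ⟩
  X *ℚ (1ℚ - Y) *ℚ (b₁ *ℚ (φ x (suc u) *ℚ φ x v)) +ℚ (1ℚ - X) *ℚ (b₀ *ℚ (φ x u *ℚ φ x (suc v)))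
    ≡⟨ cong₂ (λ a b → X *ℚ (1ℚ - Y) *ℚ a +ℚ (1ℚ - X) *ℚ b) eq₁ (B-φ x u (suc v)) ⟩
  X *ℚ (1ℚ - Y) *ℚ φ x (u + suc v) +ℚ (1ℚ - X) *ℚ φ x (u + suc v)
    ≡⟨ solve 3 (λ X Y f → X :* (con 1ℚ :- Y) :* f :+ (con 1ℚ :- X) :* f := f :* (con 1ℚ :- X :* Y)) refl X Y (φ x (u + suc v)) ⟩
  φ x (u + suc v) *ℚ (1ℚ - X *ℚ Y)
    ≡⟨ cong (λ z → φ x (u + suc v) *ℚ (1ℚ - z)) (^-+ x (suc u) (suc v)) ⟨
  φ x (suc u + suc v) ∎
  where
  open ≡-Reasoning
  X = x ^ suc u
  Y = x ^ suc v
  b₁ = B x (u + suc v) (suc u)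
  b₀ = B x (u + suc v) u
  eq₁ : b₁ *ℚ (φ x (suc u) *ℚ φ x v) ≡ φ x (u + suc v)
  eq₁ rewrite ℕ.+-suc u v = B-φ x (suc u) v

square-shift : ∀ x a j → x ^ (j * (suc a + j)) ≡ x ^ (j * (a + j)) *ℚ x ^ j
square-shift x a j = trans
  (cong (x ^_) (NS.solve 2 (λ a j → j NS.:* (NS.con 1 NS.:+ a NS.:+ j) NS.:= j NS.:* (a NS.:+ j) NS.:+ j) refl a j))
  (^-+ x (j * (a + j)) j)

square-step : ∀ x a j → x ^ (suc j * (a + suc j)) ≡ x ^ (j * (suc a + j)) *ℚ x ^ suc (a + j)
square-step x a j = trans
  (cong (x ^_) (NS.solve 2 (λ a j → (NS.con 1 NS.:+ j) NS.:* (a NS.:+ (NS.con 1 NS.:+ j)) NS.:=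
    j NS.:* (NS.con 1 NS.:+ a NS.:+ j) NS.:+ (NS.con 1 NS.:+ (a NS.:+ j))) refl a j))
  (^-+ x (j * (suc a + j)) (suc (a + j)))

-- The offset `a` is what makes induction on `N` work. Pascal's rule for [N+1 choose j] splits each
-- term; after the shift, the pieces with a common [N choose j] recombine by Pascal's rule in the
-- other factor, and `a` grows by one.
vandermonde : ∀ x N M a →
  ∑ (suc M) (λ j → x ^ (j * (a + j)) *ℚ (B x N j *ℚ B x (a + M) (a + j))) ≡ B x (N + (a + M)) (N + a)
vandermonde x zero M a = begin
  1ℚ *ℚ (1ℚ *ℚ b 0) +ℚ ∑ M (λ j → e (suc j) *ℚ (0ℚ *ℚ b (suc j)))
    ≡⟨ cong₂ _+ℚ_ (trans (ℚ.*-identityˡ (1ℚ *ℚ b 0)) (ℚ.*-identityˡ (b 0)))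
         (∑-zero M λ j _ → solve 2 (λ e b → e :* (con 0ℚ :* b) := con 0ℚ) refl (e (suc j)) (b (suc j))) ⟩
  B x (a + M) (a + 0) +ℚ 0ℚ
    ≡⟨ ℚ.+-identityʳ _ ⟩
  B x (a + M) (a + 0)
    ≡⟨ cong (B x (a + M)) (ℕ.+-identityʳ a) ⟩
  B x (a + M) a ∎
  where
  open ≡-Reasoning
  e b : ℕ → ℚ
  e j = x ^ (j * (a + j))
  b j = B x (a + M) (a + j)
vandermonde x (suc N) M a = begin
  ∑ (suc M) (λ j → e j *ℚ (B x (suc N) j *ℚ b j))
    ≡⟨ ∑-pascal M (λ j → e j *ℚ (B x (suc N) j *ℚ b j)) (λ j → e j *ℚ (x ^ j *ℚ B x N j *ℚ b j)) (λ j → e (suc j) *ℚ (B x N j *ℚ b (suc j)))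
         refl
         (λ j → solve 5 (λ E X p r s → E :* ((X :* p :+ r) :* s) := E :* (X :* p :* s) :+ E :* (r :* s)) refl
           (e (suc j)) (x ^ suc j) (B x N (suc j)) (B x N j) (b (suc j)))
         (trans (cong (λ z → e (suc M) *ℚ (B x N M *ℚ z)) (B-> x (ℕ.+-monoʳ-< a (ℕ.n<1+n M))))
           (solve 2 (λ a b → a :* (b :* con 0ℚ) := con 0ℚ) refl (e (suc M)) (B x N M))) ⟩
  ∑ (suc M) (λ j → e j *ℚ (x ^ j *ℚ B x N j *ℚ b j) +ℚ e (suc j) *ℚ (B x N j *ℚ b (suc j)))
    ≡⟨ ∑-cong (suc M) (λ j _ → step j) ⟩
  ∑ (suc M) (λ j → x ^ (j * (suc a + j)) *ℚ (B x N j *ℚ B x (suc a + M) (suc a + j)))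
    ≡⟨ vandermonde x N M (suc a) ⟩
  B x (N + suc (a + M)) (N + suc a)
    ≡⟨ cong₂ (B x) (ℕ.+-suc N (a + M)) (ℕ.+-suc N a) ⟩
  B x (suc N + (a + M)) (suc N + a) ∎
  where
  open ≡-Reasoning
  e b : ℕ → ℚ
  e j = x ^ (j * (a + j))
  b j = B x (a + M) (a + j)
  step : ∀ j → e j *ℚ (x ^ j *ℚ B x N j *ℚ b j) +ℚ e (suc j) *ℚ (B x N j *ℚ b (suc j)) ≡
    x ^ (j * (suc a + j)) *ℚ (B x N j *ℚ B x (suc a + M) (suc a + j))
  step j rewrite square-step x a j | square-shift x a j | ℕ.+-suc a j =
    solve 6 (λ e X p r s Y → e :* (X :* p :* r) :+ (e :* X) :* Y :* (p :* s) := (e :* X) :* (p :* (Y :* s :+ r))) refl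
      (e j) (x ^ j) (B x N j) (b j) (B x (a + M) (suc (a + j))) (x ^ suc (a + j))

-- Identities modulo a relation, sums with few terms, parity

-- For identities that hold only modulo a relation e = 0.
≡-modulo : ∀ {a b} e k → e ≡ 0ℚ → a ≡ b +ℚ e *ℚ k → a ≡ b
≡-modulo {b = b} e k refl eq = trans eq (solve 2 (λ b k → b :+ con 0ℚ :* k := b) refl b k)

∑-truncate : ∀ d K f → (∀ j → K ℕ.≤ j → f j ≡ 0ℚ) → ∑ (d + K) f ≡ ∑ K f
∑-truncate zero    K f f≡0 = refl
∑-truncate (suc d) K f f≡0 = trans (∑-snoc (d + K) f)
  (trans (cong₂ _+ℚ_ (∑-truncate d K f f≡0) (f≡0 (d + K) (ℕ.m≤n+m K d))) (ℚ.+-identityʳ (∑ K f)))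

*-monoˡ : ∀ {a b c} → 0ℚ ≤ c → a ≤ b → a *ℚ c ≤ b *ℚ c
*-monoˡ {c = c} 0≤c = ℚ.*-monoʳ-≤-nonNeg c {{nonNegative 0≤c}}

≤-inv : ∀ {p} → 0ℚ ℚ.< p → p ≤ 1ℚ → 1ℚ ≤ inv p
≤-inv {p} 0<p p≤1 = subst₂ _≤_ (*-inv 0<p) (ℚ.*-identityˡ (inv p)) (*-monoˡ (ℚ.<⇒≤ (0<inv 0<p)) p≤1)

0≤inv : ∀ {p} → 0ℚ ℚ.< p → 0ℚ ≤ inv p
0≤inv 0<p = ℚ.<⇒≤ (0<inv 0<p)

-‿≤ : ∀ {a} b → 0ℚ ≤ b → a - b ≤ a
-‿≤ {a} b 0≤b = ≤-from-gap b 0≤b (solve 2 (λ a b → a := a :- b :+ b) refl a b)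

even-or-odd : ∀ k → ∃[ h ] (k ≡ h + h ⊎ k ≡ suc (h + h))
even-or-odd zero = 0 , inj₁ refl
even-or-odd (suc k) with even-or-odd k
... | h , inj₁ refl = h , inj₂ refl
... | h , inj₂ refl = suc h , inj₁ (cong suc (sym (ℕ.+-suc h h)))

∑-single : ∀ {K f p} → p < K → (∀ j → j ≢ p → f j ≡ 0ℚ) → ∑ K f ≡ f p
∑-single {suc K} {f} {zero}  _         f≡0 = trans
  (cong (f 0 +ℚ_) (∑-zero K λ j _ → f≡0 (suc j) λ ())) (ℚ.+-identityʳ (f 0))
∑-single {suc K} {f} {suc p} (s≤s p<K) f≡0 = trans
  (cong₂ _+ℚ_ (f≡0 0 λ ()) (∑-single p<K λ j j≢p → f≡0 (suc j) (j≢p ∘ ℕ.suc-injective))) (ℚ.+-identityˡ (f (suc p)))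

-- Sums over multiplicity vectors

-- The head entry m_1 is summed innermost, with the tail fixed: the tail is the partition without
-- its first column.
vsum : (k b : ℕ) → (Vec ℕ k → ℚ) → ℚ
vsum zero    b g = g []
vsum (suc k) b g = vsum k b λ v → ∑ (suc b) λ a → g (a ∷ v)

vsum-cong : ∀ k b {g h} → (∀ v → g v ≡ h v) → vsum k b g ≡ vsum k b h
vsum-cong zero    b eq = eq []
vsum-cong (suc k) b eq = vsum-cong k b λ v → ∑-cong (suc b) λ a _ → eq (a ∷ v)

vsum-zero : ∀ k b → vsum k b (λ _ → 0ℚ) ≡ 0ℚ
vsum-zero zero    b = refl
vsum-zero (suc k) b = trans (vsum-cong k b λ v → ∑-zero (suc b) λ _ _ → refl) (vsum-zero k b)

vsum-+ : ∀ k b g h → vsum k b (λ v → g v +ℚ h v) ≡ vsum k b g +ℚ vsum k b h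
vsum-+ zero    b g h = refl
vsum-+ (suc k) b g h = trans (vsum-cong k b λ v → ∑-+ (suc b) (λ a → g (a ∷ v)) (λ a → h (a ∷ v)))
  (vsum-+ k b (λ v → ∑ (suc b) λ a → g (a ∷ v)) (λ v → ∑ (suc b) λ a → h (a ∷ v)))

vsum-* : ∀ k b c g → vsum k b (λ v → c *ℚ g v) ≡ c *ℚ vsum k b g
vsum-* zero    b c g = refl
vsum-* (suc k) b c g = trans (vsum-cong k b λ v → ∑-* (suc b) c (λ a → g (a ∷ v)))
  (vsum-* k b c (λ v → ∑ (suc b) λ a → g (a ∷ v)))

vsum-∑ : ∀ k b K (f : Vec ℕ k → ℕ → ℚ) → vsum k b (λ v → ∑ K (f v)) ≡ ∑ K (λ j → vsum k b λ v → f v j)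
vsum-∑ k b zero    f = vsum-zero k b
vsum-∑ k b (suc K) f = trans (vsum-+ k b (λ v → f v 0) (λ v → ∑ K (f v ∘ suc)))
  (cong (vsum k b (λ v → f v 0) +ℚ_) (vsum-∑ k b K (λ v → f v ∘ suc)))

sumℚ-++ : ∀ xs ys → sumℚ (xs ++ ys) ≡ sumℚ xs +ℚ sumℚ ys
sumℚ-++ []       ys = sym (ℚ.+-identityˡ (sumℚ ys))
sumℚ-++ (x ∷ xs) ys = trans (cong (x +ℚ_) (sumℚ-++ xs ys)) (sym (ℚ.+-assoc x (sumℚ xs) (sumℚ ys)))

sumℚ-concatMap : ∀ {A C : Set} (g : C → ℚ) (h : A → List C) xs →
  sumℚ (map g (concatMap h xs)) ≡ sumℚ (map (λ v → sumℚ (map g (h v))) xs)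
sumℚ-concatMap g h []       = refl
sumℚ-concatMap g h (x ∷ xs) = begin
  sumℚ (map g (h x ++ concatMap h xs))                  ≡⟨ cong sumℚ (map-++ g (h x) (concatMap h xs)) ⟩
  sumℚ (map g (h x) ++ map g (concatMap h xs))          ≡⟨ sumℚ-++ (map g (h x)) (map g (concatMap h xs)) ⟩
  sumℚ (map g (h x)) +ℚ sumℚ (map g (concatMap h xs))   ≡⟨ cong (sumℚ (map g (h x)) +ℚ_) (sumℚ-concatMap g h xs) ⟩
  sumℚ (map g (h x)) +ℚ sumℚ (map (λ v → sumℚ (map g (h v))) xs) ∎
  where open ≡-Reasoning

sumℚ-applyUpTo : ∀ {A B : Set} (g : B → ℚ) (h : A → B) (e : ℕ → A) K →
  sumℚ (map g (map h (applyUpTo e K))) ≡ ∑ K (λ a → g (h (e a)))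
sumℚ-applyUpTo g h e zero    = refl
sumℚ-applyUpTo g h e (suc K) = cong (g (h (e 0)) +ℚ_) (sumℚ-applyUpTo g h (e ∘ suc) K)

sumℚ-allVecs : ∀ k b g → sumℚ (map g (allVecs k b)) ≡ vsum k b g
sumℚ-allVecs zero    b g = ℚ.+-identityʳ (g [])
sumℚ-allVecs (suc k) b g = begin
  sumℚ (map g (concatMap (λ v → map (_∷ v) (upTo (suc b))) (allVecs k b)))
    ≡⟨ sumℚ-concatMap g (λ v → map (_∷ v) (upTo (suc b))) (allVecs k b) ⟩
  sumℚ (map (λ v → sumℚ (map g (map (_∷ v) (upTo (suc b))))) (allVecs k b))
    ≡⟨ sumℚ-allVecs k b (λ v → sumℚ (map g (map (_∷ v) (upTo (suc b))))) ⟩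
  vsum k b (λ v → sumℚ (map g (map (_∷ v) (upTo (suc b)))))
    ≡⟨ vsum-cong k b (λ v → sumℚ-applyUpTo g (_∷ v) id (suc b)) ⟩
  vsum (suc k) b g ∎
  where open ≡-Reasoning

-- Number of parts, size and largest part

-- The column length λ'_1; on the tail of a vector it is λ'_2.
tot : ∀ {k} → Vec ℕ k → ℕ
tot []      = 0
tot (a ∷ v) = a + tot v

conj-1 : ∀ {k} (v : Vec ℕ k) → conj v 1 ≡ tot v
conj-1 []      = refl
conj-1 (a ∷ v) = cong (a +_) (conj-1 v)

weighted-suc : ∀ {k} (f : Fin k → ℕ) (v : Vec ℕ k) →
  sum (toList (tabulate λ j → suc (f j) * lookup v j)) ≡ tot v + sum (toList (tabulate λ j → f j * lookup v j))
weighted-suc f []      = refl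
weighted-suc f (a ∷ v) = trans (cong (a + f zero * a +_) (weighted-suc (f ∘ suc) v))
  (NS.solve 4 (λ a b c d → a NS.:+ b NS.:+ (c NS.:+ d) NS.:= a NS.:+ c NS.:+ (b NS.:+ d)) refl a (f zero * a) (tot v) _)

-- The first column has one cell for each of the `a + tot v` parts, and `v` describes what remains.
size-∷ : ∀ {k} a (v : Vec ℕ k) → size (a ∷ v) ≡ a + tot v + size v
size-∷ a v = trans (cong₂ _+_ (ℕ.*-identityˡ a) (weighted-suc (suc ∘ toℕ) v)) (sym (ℕ.+-assoc a (tot v) (size v)))

tot≤size : ∀ {k} (v : Vec ℕ k) → tot v ℕ.≤ size v
tot≤size []      = z≤n
tot≤size (a ∷ v) rewrite size-∷ a v = ℕ.m≤m+n (a + tot v) (size v)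

⊔-<ᵇ : ∀ a b c → (a ⊔ b <ᵇ c) ≡ (a <ᵇ c) ∧ (b <ᵇ c)
⊔-<ᵇ a       b       zero    = refl
⊔-<ᵇ zero    b       (suc c) = refl
⊔-<ᵇ (suc a) zero    (suc c) = sym (Bool.∧-identityʳ (a <ᵇ c))
⊔-<ᵇ (suc a) (suc b) (suc c) = ⊔-<ᵇ a b c

-- The condition λ₁ ≤ L, arranged so that removing a column lowers L by one, as in the recursion for
-- the weights.
small : ∀ {k} → Vec ℕ k → ℕ → Bool
small []      L       = true
small (a ∷ v) zero    = (a ≡ᵇ 0) ∧ small v zero
small (a ∷ v) (suc L) = small v L

-- `largest` with an arbitrary index function, since passing to the tail shifts the indices.
maxPart : ∀ {k} → (Fin k → ℕ) → Vec ℕ k → ℕ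
maxPart f v = foldr _⊔_ 0 (toList (tabulate λ j → if lookup v j ≡ᵇ 0 then 0 else suc (f j)))

maxPart-suc : ∀ {k} (f : Fin k → ℕ) (v : Vec ℕ k) L →
  (maxPart (suc ∘ f) v <ᵇ suc (suc L)) ≡ (maxPart f v <ᵇ suc L)
maxPart-suc f []      L = refl
maxPart-suc f (a ∷ v) L = begin
  (h₁ ⊔ maxPart (suc ∘ f ∘ suc) v <ᵇ suc (suc L))               ≡⟨ ⊔-<ᵇ h₁ (maxPart (suc ∘ f ∘ suc) v) (suc (suc L)) ⟩
  (h₁ <ᵇ suc (suc L)) ∧ (maxPart (suc ∘ f ∘ suc) v <ᵇ suc (suc L)) ≡⟨ cong₂ _∧_ (head a) (maxPart-suc (f ∘ suc) v L) ⟩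
  (h₀ <ᵇ suc L) ∧ (maxPart (f ∘ suc) v <ᵇ suc L)                ≡⟨ ⊔-<ᵇ h₀ (maxPart (f ∘ suc) v) (suc L) ⟨
  (h₀ ⊔ maxPart (f ∘ suc) v <ᵇ suc L)                           ∎
  where
  open ≡-Reasoning
  h₁ = if a ≡ᵇ 0 then 0 else suc (suc (f zero))
  h₀ = if a ≡ᵇ 0 then 0 else suc (f zero)
  head : ∀ a → ((if a ≡ᵇ 0 then 0 else suc (suc (f zero))) <ᵇ suc (suc L)) ≡ ((if a ≡ᵇ 0 then 0 else suc (f zero)) <ᵇ suc L)
  head zero    = refl
  head (suc a) = refl

maxPart-zero : ∀ {k} (f : Fin k → ℕ) (v : Vec ℕ k) → (maxPart f v <ᵇ 1) ≡ small v 0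
maxPart-zero f []          = refl
maxPart-zero f (zero ∷ v)  = maxPart-zero (f ∘ suc) v
maxPart-zero f (suc a ∷ v) = ⊔-<ᵇ (suc (f zero)) (maxPart (f ∘ suc) v) 1

largest-small : ∀ {k} (v : Vec ℕ k) L → (largest v <ᵇ suc L) ≡ small v L
largest-small v       zero    = maxPart-zero toℕ v
largest-small []      (suc L) = refl
largest-small (a ∷ v) (suc L) = begin
  (h ⊔ maxPart (suc ∘ toℕ) v <ᵇ suc (suc L))                     ≡⟨ ⊔-<ᵇ h (maxPart (suc ∘ toℕ) v) (suc (suc L)) ⟩
  (h <ᵇ suc (suc L)) ∧ (maxPart (suc ∘ toℕ) v <ᵇ suc (suc L))    ≡⟨ cong₂ _∧_ (head a) (trans (maxPart-suc toℕ v L) (largest-small v L)) ⟩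
  small v L                                                      ∎
  where
  open ≡-Reasoning
  h = if a ≡ᵇ 0 then 0 else 1
  head : ∀ a → ((if a ≡ᵇ 0 then 0 else 1) <ᵇ suc (suc L)) ≡ true
  head zero    = refl
  head (suc a) = refl

≡ᵇ-refl : ∀ n → (n ≡ᵇ n) ≡ true
≡ᵇ-refl n = dec-true (n ℕ.≟ n) refl

≢⇒≡ᵇ-false : ∀ {m n} → m ≢ n → (m ≡ᵇ n) ≡ false
≢⇒≡ᵇ-false {m} {n} = dec-false (m ℕ.≟ n)

+-cancel-≡ᵇ : ∀ s m n → (s + m ≡ᵇ n + s) ≡ (m ≡ᵇ n)
+-cancel-≡ᵇ s m n rewrite ℕ.+-comm n s = go s
  where
  go : ∀ s → (s + m ≡ᵇ s + n) ≡ (m ≡ᵇ n)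
  go zero    = refl
  go (suc s) = go s

-- Powers and reciprocal q-factorials at 0 < x ≤ 1/2

module Weights (x : ℚ) (0<x : 0ℚ ℚ.< x) (2x≤1 : x +ℚ x ≤ 1ℚ) where

  0≤x : 0ℚ ≤ x
  0≤x = ℚ.<⇒≤ 0<x

  0≤x^ : ∀ k → 0ℚ ≤ x ^ k
  0≤x^ k = ℚ.<⇒≤ (0<^ 0<x k)

  x≤1-x : x ≤ 1ℚ - x
  x≤1-x = ≤-from-gap (1ℚ - (x +ℚ x)) (gap 2x≤1)
    (solve 1 (λ x → con 1ℚ :- x := x :+ (con 1ℚ :- (x :+ x))) refl x)

  x≤1 : x ≤ 1ℚ
  x≤1 = ℚ.≤-trans (≤-from-gap x 0≤x refl) 2x≤1

  x^suc≤x^ : ∀ k → x ^ suc k ≤ x ^ k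
  x^suc≤x^ k = subst₂ _≤_ (ℚ.*-comm (x ^ k) x) (ℚ.*-identityʳ (x ^ k)) (*-monoʳ (0≤x^ k) x≤1)

  x^-antitone : ∀ {k l} → k ℕ.≤ l → x ^ l ≤ x ^ k
  x^-antitone {k} k≤l with ℕ.≤⇒≤′ k≤l
  ... | k≤′l = go k≤′l
    where
    go : ∀ {l} → k ℕ.≤′ l → x ^ l ≤ x ^ k
    go (ℕ.≤′-reflexive refl) = ℚ.≤-refl
    go (ℕ.≤′-step {l} k≤l) = ℚ.≤-trans (x^suc≤x^ l) (go k≤l)

  x^suc≤x : ∀ k → x ^ suc k ≤ x
  x^suc≤x k = subst (x ^ suc k ≤_) (ℚ.*-identityʳ x) (x^-antitone {1} (s≤s (z≤n {k})))

  0<1-x^suc : ∀ k → 0ℚ ℚ.< 1ℚ - x ^ suc k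
  0<1-x^suc k = ℚ.<-≤-trans 0<x
    (ℚ.≤-trans x≤1-x (ℚ.+-monoʳ-≤ 1ℚ (ℚ.neg-antimono-≤ (x^suc≤x k))))

  0<φ : ∀ k → 0ℚ ℚ.< φ x k
  0<φ zero    = 0<1
  0<φ (suc k) = 0<* (0<φ k) (0<1-x^suc k)

  abstract
    i : ℕ → ℚ
    i k = inv (φ x k)

    i≡inv : ∀ k → i k ≡ inv (φ x k)
    i≡inv k = refl

    0≤i : ∀ k → 0ℚ ≤ i k
    0≤i k = ℚ.<⇒≤ (0<inv (0<φ k))

    φ*i : ∀ k → φ x k *ℚ i k ≡ 1ℚ
    φ*i k = *-inv (0<φ k)

  i-0 : i 0 ≡ 1ℚ
  i-0 = i≡inv 0

  i-suc : ∀ k → i k ≡ i (suc k) *ℚ (1ℚ - x ^ suc k)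
  i-suc k = trans (i≡inv k) (inv-unique _ (0<φ k) (trans
    (solve 3 (λ f i y → f :* (i :* y) := (f :* y) :* i) refl (φ x k) (i (suc k)) (1ℚ - x ^ suc k))
    (φ*i (suc k))))

  i≤i-suc : ∀ k → i k ≤ i (suc k)
  i≤i-suc k = ≤-from-gap (i (suc k) *ℚ x ^ suc k) (0≤* (0≤i (suc k)) (0≤x^ (suc k)))
    (trans (solve 2 (λ i y → i := i :* (con 1ℚ :- y) :+ i :* y) refl (i (suc k)) (x ^ suc k))
           (cong (_+ℚ i (suc k) *ℚ x ^ suc k) (sym (i-suc k))))

  -- `B-φ` with reciprocals in place of the factorials. It merges the factors of two successive
  -- columns into one Gaussian binomial over a common `i`.
  B-i : ∀ u v → B x (u + v) u *ℚ i (u + v) ≡ i u *ℚ i v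
  B-i u v = begin
    b *ℚ i (u + v)
      ≡⟨ solve 2 (λ b f → b :* f := b :* f :* con 1ℚ :* con 1ℚ) refl b (i (u + v)) ⟩
    b *ℚ i (u + v) *ℚ 1ℚ *ℚ 1ℚ
      ≡⟨ cong₂ (λ a c → b *ℚ i (u + v) *ℚ a *ℚ c) (φ*i u) (φ*i v) ⟨
    b *ℚ i (u + v) *ℚ (φ x u *ℚ i u) *ℚ (φ x v *ℚ i v)
      ≡⟨ solve 6 (λ b f g g' h h' → b :* f :* (g :* g') :* (h :* h') := (b :* (g :* h)) :* f :* (g' :* h')) refl
           b (i (u + v)) (φ x u) (i u) (φ x v) (i v) ⟩
    b *ℚ (φ x u *ℚ φ x v) *ℚ i (u + v) *ℚ (i u *ℚ i v)
      ≡⟨ cong (λ z → z *ℚ i (u + v) *ℚ (i u *ℚ i v)) (B-φ x u v) ⟩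
    φ x (u + v) *ℚ i (u + v) *ℚ (i u *ℚ i v)
      ≡⟨ cong (_*ℚ (i u *ℚ i v)) (φ*i (u + v)) ⟩
    1ℚ *ℚ (i u *ℚ i v)
      ≡⟨ ℚ.*-identityˡ _ ⟩
    i u *ℚ i v ∎
    where
    open ≡-Reasoning
    b = B x (u + v) u

  -- The recursion for `B` is lopsided; the quotient form is symmetric.
  B-sym : ∀ u v → B x (u + v) u ≡ B x (u + v) v
  B-sym u v = begin
    B x (u + v) u                       ≡⟨ unfold u v ⟩
    i u *ℚ i v *ℚ φ x (u + v)           ≡⟨ cong₂ _*ℚ_ (ℚ.*-comm (i u) (i v)) (cong (φ x) (ℕ.+-comm u v)) ⟩
    i v *ℚ i u *ℚ φ x (v + u)           ≡⟨ unfold v u ⟨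
    B x (v + u) v                       ≡⟨ cong (λ n → B x n v) (ℕ.+-comm v u) ⟩
    B x (u + v) v                       ∎
    where
    open ≡-Reasoning
    unfold : ∀ u v → B x (u + v) u ≡ i u *ℚ i v *ℚ φ x (u + v)
    unfold u v = begin
      B x (u + v) u                                 ≡⟨ ℚ.*-identityʳ _ ⟨
      B x (u + v) u *ℚ 1ℚ                           ≡⟨ cong (B x (u + v) u *ℚ_) (φ*i (u + v)) ⟨
      B x (u + v) u *ℚ (φ x (u + v) *ℚ i (u + v))   ≡⟨ solve 3 (λ b f g → b :* (f :* g) := b :* g :* f) refl (B x (u + v) u) (φ x (u + v)) (i (u + v)) ⟩
      B x (u + v) u *ℚ i (u + v) *ℚ φ x (u + v)     ≡⟨ cong (_*ℚ φ x (u + v)) (B-i u v) ⟩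
      i u *ℚ i v *ℚ φ x (u + v)                     ∎

  -- The limit M → ∞ of vandermonde, up to normalisation; the case a = 1 sums the weights over the number of parts.
  durfee : ∀ N M a → N ℕ.≤ M →
    ∑ (suc M) (λ j → x ^ (j * (a + j)) *ℚ (B x N j *ℚ i (a + j))) ≡ i (N + a)
  durfee zero M a _ = begin
    1ℚ *ℚ (1ℚ *ℚ i (a + 0)) +ℚ ∑ M (λ j → e (suc j) *ℚ (0ℚ *ℚ i (a + suc j)))
      ≡⟨ cong₂ _+ℚ_ (trans (ℚ.*-identityˡ (1ℚ *ℚ i (a + 0))) (ℚ.*-identityˡ (i (a + 0))))
           (∑-zero M λ j _ → solve 2 (λ e b → e :* (con 0ℚ :* b) := con 0ℚ) refl (e (suc j)) (i (a + suc j))) ⟩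
    i (a + 0) +ℚ 0ℚ
      ≡⟨ ℚ.+-identityʳ _ ⟩
    i (a + 0)
      ≡⟨ cong i (ℕ.+-identityʳ a) ⟩
    i a ∎
    where
    open ≡-Reasoning
    e : ℕ → ℚ
    e j = x ^ (j * (a + j))
  durfee (suc N) M a N<M = begin
    ∑ (suc M) (λ j → e j *ℚ (B x (suc N) j *ℚ i (a + j)))
      ≡⟨ ∑-pascal M (λ j → e j *ℚ (B x (suc N) j *ℚ i (a + j)))
           (λ j → e j *ℚ (x ^ j *ℚ B x N j *ℚ i (a + j)))
           (λ j → e (suc j) *ℚ (B x N j *ℚ i (a + suc j)))
           refl
           (λ j → solve 5 (λ E X p r s → E :* ((X :* p :+ r) :* s) := E :* (X :* p :* s) :+ E :* (r :* s)) refl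
             (e (suc j)) (x ^ suc j) (B x N (suc j)) (B x N j) (i (a + suc j)))
           -- The boundary term vanishes because the range of summation reaches beyond N.
           (trans (cong (λ z → e (suc M) *ℚ (z *ℚ i (a + suc M))) (B-> x N<M))
             (solve 2 (λ a b → a :* (con 0ℚ :* b) := con 0ℚ) refl (e (suc M)) (i (a + suc M)))) ⟩
    ∑ (suc M) (λ j → e j *ℚ (x ^ j *ℚ B x N j *ℚ i (a + j)) +ℚ e (suc j) *ℚ (B x N j *ℚ i (a + suc j)))
      ≡⟨ ∑-cong (suc M) (λ j _ → step j) ⟩
    ∑ (suc M) (λ j → x ^ (j * (suc a + j)) *ℚ (B x N j *ℚ i (suc a + j)))
      ≡⟨ durfee N M (suc a) (ℕ.<⇒≤ N<M) ⟩
    i (N + suc a)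
      ≡⟨ cong i (ℕ.+-suc N a) ⟩
    i (suc N + a) ∎
    where
    open ≡-Reasoning
    e : ℕ → ℚ
    e j = x ^ (j * (a + j))
    step : ∀ j → e j *ℚ (x ^ j *ℚ B x N j *ℚ i (a + j)) +ℚ e (suc j) *ℚ (B x N j *ℚ i (a + suc j)) ≡
      x ^ (j * (suc a + j)) *ℚ (B x N j *ℚ i (suc a + j))
    -- Pascal's rule for the second binomial is replaced by i(a+j) = (1 - Y) i(a+j+1): adding Y
    -- i(a+j+1) from the shifted term leaves i(a+j+1).
    step j = begin
      e j *ℚ (x ^ j *ℚ B x N j *ℚ i (a + j)) +ℚ e (suc j) *ℚ (B x N j *ℚ i (a + suc j))
        ≡⟨ cong₂ (λ u v → e j *ℚ (x ^ j *ℚ B x N j *ℚ u) +ℚ v *ℚ (B x N j *ℚ i (a + suc j))) (i-suc (a + j)) (square-step x a j) ⟩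
      e j *ℚ (x ^ j *ℚ B x N j *ℚ (I *ℚ (1ℚ - Y))) +ℚ x ^ (j * (suc a + j)) *ℚ Y *ℚ (B x N j *ℚ i (a + suc j))
        ≡⟨ cong₂ (λ u v → e j *ℚ (x ^ j *ℚ B x N j *ℚ (I *ℚ (1ℚ - Y))) +ℚ u *ℚ Y *ℚ (B x N j *ℚ v))
             (square-shift x a j) (cong i (ℕ.+-suc a j)) ⟩
      e j *ℚ (x ^ j *ℚ B x N j *ℚ (I *ℚ (1ℚ - Y))) +ℚ e j *ℚ x ^ j *ℚ Y *ℚ (B x N j *ℚ I)
        ≡⟨ solve 5 (λ e X p s Y → e :* (X :* p :* (s :* (con 1ℚ :- Y))) :+ (e :* X) :* Y :* (p :* s) := (e :* X) :* (p :* s)) refl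
             (e j) (x ^ j) (B x N j) I Y ⟩
      e j *ℚ x ^ j *ℚ (B x N j *ℚ I)
        ≡⟨ cong (_*ℚ (B x N j *ℚ I)) (square-shift x a j) ⟨
      x ^ (j * (suc a + j)) *ℚ (B x N j *ℚ I) ∎
      where
      I = i (suc (a + j))
      Y = x ^ suc (a + j)

  -- The column recursion and its solution

  -- T k n s is the total weight of the partitions of n with parts at most k and exactly s parts.
  T : ℕ → ℕ → ℕ → ℚ
  T zero    zero    zero    = 1ℚ
  T zero    zero    (suc _) = 0ℚ
  T zero    (suc _) _       = 0ℚ
  T (suc k) n s = if s ℕ.≤ᵇ n
    then x ^ (s * s) *ℚ ∑ (suc s) (λ j → i (s ∸ j) *ℚ T k (n ∸ s) j)
    else 0ℚ

  T-suc : ∀ k m s → T (suc k) (m + s) s ≡ x ^ (s * s) *ℚ ∑ (suc s) (λ j → i (s ∸ j) *ℚ T k m j)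
  T-suc k m s with s ℕ.≤ᵇ (m + s) | ℕ.≤⇒≤ᵇ (ℕ.m≤n+m s m)
  ... | true | _ rewrite ℕ.m+n∸n≡m m s = refl

  T-< : ∀ k {n s} → n < s → T k n s ≡ 0ℚ
  T-< zero    {zero}  {suc s} _ = refl
  T-< zero    {suc n} _ = refl
  T-< (suc k) {n} {s} n<s with s ℕ.≤ᵇ n | ℕ.≤ᵇ⇒≤ s n
  ... | false | _  = refl
  ... | true  | le = contradiction (le _) (ℕ.<⇒≱ n<s)

  T-0-0 : ∀ k → T k 0 0 ≡ 1ℚ
  T-0-0 zero    = refl
  T-0-0 (suc k) rewrite T-0-0 k | i-0 = refl

  T-suc-0 : ∀ k n → T k (suc n) 0 ≡ 0ℚ
  T-suc-0 zero    n = refl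
  T-suc-0 (suc k) n rewrite T-suc-0 k n | i-0 = refl

  0≤T : ∀ k n s → 0ℚ ≤ T k n s
  0≤T zero    zero    zero    = 0≤1
  0≤T zero    zero    (suc _) = ℚ.≤-refl
  0≤T zero    (suc _) _       = ℚ.≤-refl
  0≤T (suc k) n s with s ℕ.≤ᵇ n
  ... | true  = 0≤* (0≤x^ (s * s)) (∑-nonneg (suc s) λ j → 0≤* (0≤i (s ∸ j)) (0≤T k (n ∸ s) j))
  ... | false = ℚ.≤-refl

  T-mono : ∀ k n s → T k n s ≤ T (suc k) n s
  T-mono zero    zero    zero    = ℚ.≤-reflexive (sym (T-0-0 1))
  T-mono zero    zero    (suc _) = ℚ.≤-refl
  T-mono zero    (suc n) s       = 0≤T 1 (suc n) s
  T-mono (suc k) n s with s ℕ.≤ᵇ n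
  ... | true  = *-monoʳ (0≤x^ (s * s)) (∑-mono (suc s) λ j → *-monoʳ (0≤i (s ∸ j)) (T-mono k (n ∸ s) j))
  ... | false = ℚ.≤-refl

  -- The hypothesis makes the bound on the parts vacuous. After the first column is removed, `B-i`
  -- turns the induction hypothesis into a q-Vandermonde sum with offset 1, the exponent being
  -- j(j+1). Size and number of parts are shifted by one because the empty partition does not fit
  -- the formula.
  T-closed : ∀ k n s → n < k →
    T k (suc n) (suc s) ≡ x ^ suc n *ℚ (x ^ (s * suc s) *ℚ (B x n s *ℚ i (suc s)))
  T-closed (suc k) n s (s≤s n≤k) with s ℕ.≤? n
  ... | no s≰n = trans (T-< (suc k) (s≤s (ℕ.≰⇒> s≰n))) (sym (trans
    (cong (λ b → x ^ suc n *ℚ (x ^ (s * suc s) *ℚ (b *ℚ i (suc s)))) (B-> x (ℕ.≰⇒> s≰n)))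
    (solve 3 (λ a b c → a :* (b :* (con 0ℚ :* c)) := con 0ℚ) refl (x ^ suc n) (x ^ (s * suc s)) (i (suc s)))))
  ... | yes s≤n = subst (λ n → T (suc k) (suc n) (suc s) ≡ x ^ suc n *ℚ (x ^ (s * suc s) *ℚ (B x n s *ℚ i (suc s))))
                    (ℕ.m∸n+n≡m s≤n) (go (n ∸ s) (subst (ℕ._≤ k) (sym (ℕ.m∸n+n≡m s≤n)) n≤k))
    where
    open ≡-Reasoning
    peel : ∀ p → T (suc k) (suc (p + s)) (suc s) ≡
      x ^ (suc s * suc s) *ℚ (i (suc s) *ℚ T k p 0 +ℚ ∑ (suc s) (λ j → i (s ∸ j) *ℚ T k p (suc j)))
    peel p = trans (cong (λ n → T (suc k) n (suc s)) (sym (ℕ.+-suc p s))) (T-suc k p (suc s))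
    go : ∀ p → p + s ℕ.≤ k → T (suc k) (suc (p + s)) (suc s) ≡
      x ^ suc (p + s) *ℚ (x ^ (s * suc s) *ℚ (B x (p + s) s *ℚ i (suc s)))
    -- Nothing remains beside the first column, so only the term with no further parts survives.
    go zero _ = begin
      T (suc k) (suc s) (suc s)
        ≡⟨ peel 0 ⟩
      x ^ (suc s * suc s) *ℚ (i (suc s) *ℚ T k 0 0 +ℚ ∑ (suc s) (λ j → i (s ∸ j) *ℚ T k 0 (suc j)))
        ≡⟨ cong₂ (λ a b → x ^ (suc s * suc s) *ℚ (i (suc s) *ℚ a +ℚ b)) (T-0-0 k)
             (∑-zero (suc s) λ j _ → trans (cong (i (s ∸ j) *ℚ_) (T-< k {0} {suc j} (s≤s z≤n))) (ℚ.*-zeroʳ (i (s ∸ j)))) ⟩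
      x ^ (suc s * suc s) *ℚ (i (suc s) *ℚ 1ℚ +ℚ 0ℚ)
        ≡⟨ cong (_*ℚ (i (suc s) *ℚ 1ℚ +ℚ 0ℚ)) (^-+ x (suc s) (s * suc s)) ⟩
      x ^ suc s *ℚ x ^ (s * suc s) *ℚ (i (suc s) *ℚ 1ℚ +ℚ 0ℚ)
        ≡⟨ solve 3 (λ a b c → a :* b :* (c :* con 1ℚ :+ con 0ℚ) := a :* (b :* (con 1ℚ :* c))) refl (x ^ suc s) (x ^ (s * suc s)) (i (suc s)) ⟩
      x ^ suc s *ℚ (x ^ (s * suc s) *ℚ (1ℚ *ℚ i (suc s)))
        ≡⟨ cong (λ b → x ^ suc s *ℚ (x ^ (s * suc s) *ℚ (b *ℚ i (suc s)))) (B-diag x s) ⟨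
      x ^ suc s *ℚ (x ^ (s * suc s) *ℚ (B x s s *ℚ i (suc s))) ∎
    go (suc p) p+s<k = begin
      T (suc k) (suc (suc p + s)) (suc s)
        ≡⟨ peel (suc p) ⟩
      x ^ (suc s * suc s) *ℚ (i (suc s) *ℚ T k (suc p) 0 +ℚ ∑ (suc s) (λ j → i (s ∸ j) *ℚ T k (suc p) (suc j)))
        ≡⟨ cong₂ (λ a b → x ^ (suc s * suc s) *ℚ (i (suc s) *ℚ a +ℚ b)) (T-suc-0 k p)
             (∑-cong (suc s) λ { j (s≤s j≤s) → term j j≤s }) ⟩
      x ^ (suc s * suc s) *ℚ (i (suc s) *ℚ 0ℚ +ℚ ∑ (suc s) (λ j → c *ℚ v j))
        ≡⟨ cong (λ z → x ^ (suc s * suc s) *ℚ (i (suc s) *ℚ 0ℚ +ℚ z)) (∑-* (suc s) c v) ⟩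
      x ^ (suc s * suc s) *ℚ (i (suc s) *ℚ 0ℚ +ℚ c *ℚ ∑ (suc s) v)
        ≡⟨ cong₂ (λ a b → a *ℚ (i (suc s) *ℚ 0ℚ +ℚ c *ℚ b)) (^-+ x (suc s) (s * suc s)) vander ⟩
      (x ^ suc s *ℚ x ^ (s * suc s)) *ℚ (i (suc s) *ℚ 0ℚ +ℚ x ^ suc p *ℚ i (suc s) *ℚ B x (suc p + s) s)
        ≡⟨ solve 5 (λ a b i d e → (a :* b) :* (i :* con 0ℚ :+ d :* i :* e) := d :* a :* (b :* (e :* i))) refl
             (x ^ suc s) (x ^ (s * suc s)) (i (suc s)) (x ^ suc p) (B x (suc p + s) s) ⟩
      x ^ suc p *ℚ x ^ suc s *ℚ (x ^ (s * suc s) *ℚ (B x (suc p + s) s *ℚ i (suc s)))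
        ≡⟨ cong (_*ℚ (x ^ (s * suc s) *ℚ (B x (suc p + s) s *ℚ i (suc s))))
             (trans (cong (x ^_) (sym (ℕ.+-suc (suc p) s))) (^-+ x (suc p) (suc s))) ⟨
      x ^ suc (suc p + s) *ℚ (x ^ (s * suc s) *ℚ (B x (suc p + s) s *ℚ i (suc s))) ∎
      where
      c = x ^ suc p *ℚ i (suc s)
      v : ℕ → ℚ
      v j = x ^ (j * suc j) *ℚ (B x p j *ℚ B x (suc s) (suc j))
      vander : ∑ (suc s) v ≡ B x (suc p + s) s
      vander = begin
        ∑ (suc s) v              ≡⟨ vandermonde x p s 1 ⟩
        B x (p + suc s) (p + 1)  ≡⟨ cong₂ (B x) (ℕ.+-suc p s) (ℕ.+-comm p 1) ⟩
        B x (suc p + s) (suc p)  ≡⟨ B-sym (suc p) s ⟩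
        B x (suc p + s) s        ∎
      term : ∀ j → j ℕ.≤ s → i (s ∸ j) *ℚ T k (suc p) (suc j) ≡ c *ℚ v j
      term j j≤s = begin
        i (s ∸ j) *ℚ T k (suc p) (suc j)
          ≡⟨ cong (i (s ∸ j) *ℚ_) (T-closed k p j (ℕ.≤-trans (s≤s (ℕ.m≤m+n p s)) p+s<k)) ⟩
        i (s ∸ j) *ℚ (x ^ suc p *ℚ (x ^ (j * suc j) *ℚ (B x p j *ℚ i (suc j))))
          ≡⟨ solve 5 (λ a b c d e → a :* (b :* (c :* (d :* e))) := b :* (c :* (d :* (e :* a)))) refl
               (i (s ∸ j)) (x ^ suc p) (x ^ (j * suc j)) (B x p j) (i (suc j)) ⟩
        x ^ suc p *ℚ (x ^ (j * suc j) *ℚ (B x p j *ℚ (i (suc j) *ℚ i (s ∸ j))))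
          ≡⟨ cong (λ z → x ^ suc p *ℚ (x ^ (j * suc j) *ℚ (B x p j *ℚ z))) (B-i (suc j) (s ∸ j)) ⟨
        x ^ suc p *ℚ (x ^ (j * suc j) *ℚ (B x p j *ℚ (B x (suc j + (s ∸ j)) (suc j) *ℚ i (suc j + (s ∸ j)))))
          ≡⟨ cong (λ n → x ^ suc p *ℚ (x ^ (j * suc j) *ℚ (B x p j *ℚ (B x (suc n) (suc j) *ℚ i (suc n))))) (ℕ.m+[n∸m]≡n j≤s) ⟩
        x ^ suc p *ℚ (x ^ (j * suc j) *ℚ (B x p j *ℚ (B x (suc s) (suc j) *ℚ i (suc s))))
          ≡⟨ solve 5 (λ a b c d e → a :* (b :* (c :* (d :* e))) := a :* e :* (b :* (c :* d))) refl
               (x ^ suc p) (x ^ (j * suc j)) (B x p j) (B x (suc s) (suc j)) (i (suc s)) ⟩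
        c *ℚ v j ∎

  -- Total weight of the partitions of n with bounded parts

  S : ℕ → ℕ → ℚ
  S k n = ∑ (suc n) (T k n)

  -- Multiplied by q^n (1/q)_n, this is the statement that P has total mass 1.
  S-closed : ∀ k n → n ℕ.≤ k → S k n ≡ x ^ n *ℚ i n
  S-closed k zero    _   rewrite T-0-0 k | i-0 = refl
  S-closed k (suc n) n<k = begin
    T k (suc n) 0 +ℚ ∑ (suc n) (T k (suc n) ∘ suc)
      ≡⟨ cong₂ _+ℚ_ (T-suc-0 k n) (∑-cong (suc n) λ s _ → T-closed k n s n<k) ⟩
    0ℚ +ℚ ∑ (suc n) (λ s → x ^ suc n *ℚ (x ^ (s * suc s) *ℚ (B x n s *ℚ i (suc s))))
      ≡⟨ trans (ℚ.+-identityˡ _) (∑-* (suc n) (x ^ suc n) (λ s → x ^ (s * suc s) *ℚ (B x n s *ℚ i (suc s)))) ⟩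
    x ^ suc n *ℚ ∑ (suc n) (λ s → x ^ (s * suc s) *ℚ (B x n s *ℚ i (suc s)))
      ≡⟨ cong (x ^ suc n *ℚ_) (durfee n n 1 ℕ.≤-refl) ⟩
    x ^ suc n *ℚ i (n + 1)
      ≡⟨ cong (λ m → x ^ suc n *ℚ i m) (ℕ.+-comm n 1) ⟩
    x ^ suc n *ℚ i (suc n) ∎
    where open ≡-Reasoning

  -- Inserting a new largest part

  T-1-diag : ∀ s → T 1 s s ≡ x ^ (s * s) *ℚ i s
  T-1-diag s = trans (T-suc 0 0 s) (cong (x ^ (s * s) *ℚ_) (begin
    i s *ℚ 1ℚ +ℚ ∑ s (λ j → i (s ∸ suc j) *ℚ 0ℚ)
      ≡⟨ cong₂ _+ℚ_ (ℚ.*-identityʳ (i s)) (∑-zero s λ j _ → ℚ.*-zeroʳ (i (s ∸ suc j))) ⟩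
    i s +ℚ 0ℚ
      ≡⟨ ℚ.+-identityʳ (i s) ⟩
    i s ∎))
    where open ≡-Reasoning

  T-1-off : ∀ p s → T 1 (suc p + s) s ≡ 0ℚ
  T-1-off p s = trans (T-suc 0 (suc p) s) (trans
    (cong (x ^ (s * s) *ℚ_) (∑-zero (suc s) λ j _ → ℚ.*-zeroʳ (i (s ∸ j)))) (ℚ.*-zeroʳ (x ^ (s * s))))

  T-peel : ∀ k p s → T (suc k) (suc (p + s)) (suc s) ≡
    x ^ (suc s * suc s) *ℚ (i (suc s) *ℚ T k p 0 +ℚ ∑ (suc s) (λ j → i (s ∸ j) *ℚ T k p (suc j)))
  T-peel k p s = trans (cong (λ n → T (suc k) n (suc s)) (sym (ℕ.+-suc p s))) (T-suc k p (suc s))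

  T-gap-trivial : ∀ l m s c n e → T (suc l) m s ≡ 0ℚ →
    T l n (suc s) +ℚ c *ℚ x ^ e *ℚ T (suc l) m s ≤ T (suc l) n (suc s)
  T-gap-trivial l m s c n e T≡0 = subst (_≤ T (suc l) n (suc s))
    (sym (trans (cong (λ z → T l n (suc s) +ℚ c *ℚ x ^ e *ℚ z) T≡0)
      (solve 2 (λ a b → a :+ b :* con 0ℚ := a) refl (T l n (suc s)) (c *ℚ x ^ e))))
    (T-mono l n (suc s))

  -- The partitions counted by T (suc l) but not by T l have largest part l + 1.  They arise from partitions of m
  -- by adding that part, which multiplies the weight by x^(m + n), n = l + 1 + m, and by a factor that is at least
  -- 1 and equals i 1 if m ≤ l.
  T-gap : ∀ l m s c → c ≤ i 1 → (l < m → c ≤ 1ℚ) →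
    T l (suc (l + m)) (suc s) +ℚ c *ℚ x ^ (m + suc (l + m)) *ℚ T (suc l) m s ≤ T (suc l) (suc (l + m)) (suc s)
  T-gap l m s c c≤i₁ c≤1 with s ℕ.≤? m
  ... | no s≰m = T-gap-trivial l m s c (suc (l + m)) (m + suc (l + m)) (T-< (suc l) (ℕ.≰⇒> s≰m))
  ... | yes s≤m = subst
      (λ m → (l < m → c ≤ 1ℚ) →
        T l (suc (l + m)) (suc s) +ℚ c *ℚ x ^ (m + suc (l + m)) *ℚ T (suc l) m s ≤ T (suc l) (suc (l + m)) (suc s))
      (ℕ.m∸n+n≡m s≤m) (go l (m ∸ s)) c≤1
    where
    -- Removing the first column on both sides reduces the claim to `l` and `p`. The new row is
    -- longer than 1, so the number s - j of parts equal to 1, and with it the factor `i (s ∸ j)`,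
    -- is the same before and after the insertion.
    step : ∀ l p → (l < p → c ≤ 1ℚ) →
      T (suc l) (suc (suc l + (p + s))) (suc s) +ℚ c *ℚ x ^ (p + s + suc (suc l + (p + s))) *ℚ T (suc (suc l)) (p + s) s
        ≤ T (suc (suc l)) (suc (suc l + (p + s))) (suc s)
    go : ∀ l p → (l < p + s → c ≤ 1ℚ) →
      T l (suc (l + (p + s))) (suc s) +ℚ c *ℚ x ^ (p + s + suc (l + (p + s))) *ℚ T (suc l) (p + s) s
        ≤ T (suc l) (suc (l + (p + s))) (suc s)
    go zero (suc p) _ = T-gap-trivial 0 (suc p + s) s c (suc (suc p + s)) (suc p + s + suc (suc p + s)) (T-1-off p s)
    -- All parts are 1 and the multiplicity rises from s to s + 1. What remains is c · i(s) ≤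
    -- i(s+1): for s = 0 from c ≤ i(1), for s > 0 from c ≤ 1.
    go zero zero h = subst₂ _≤_ eqˡ (sym (T-1-diag (suc s))) (*-monoʳ (0≤x^ (suc s * suc s)) (c*i≤ s h))
      where
      c*i≤ : ∀ s → (0 < s → c ≤ 1ℚ) → c *ℚ i s ≤ i (suc s)
      c*i≤ zero    _ = subst (_≤ i 1) (sym (trans (cong (c *ℚ_) i-0) (ℚ.*-identityʳ c))) c≤i₁
      c*i≤ (suc s) h = ℚ.≤-trans (*-monoˡ (0≤i (suc s)) (h (s≤s z≤n)))
        (subst (_≤ i (suc (suc s))) (sym (ℚ.*-identityˡ (i (suc s)))) (i≤i-suc (suc s)))
      eqˡ : x ^ (suc s * suc s) *ℚ (c *ℚ i s) ≡ 0ℚ +ℚ c *ℚ x ^ (s + suc s) *ℚ T 1 s s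
      eqˡ = begin
        x ^ (suc s * suc s) *ℚ (c *ℚ i s)
          ≡⟨ cong (λ e → x ^ e *ℚ (c *ℚ i s)) (NS.solve 1 (λ s → (NS.con 1 NS.:+ s) NS.:* (NS.con 1 NS.:+ s) NS.:= s NS.:+ (NS.con 1 NS.:+ s) NS.:+ s NS.:* s) refl s) ⟩
        x ^ (s + suc s + s * s) *ℚ (c *ℚ i s)
          ≡⟨ cong (_*ℚ (c *ℚ i s)) (^-+ x (s + suc s) (s * s)) ⟩
        x ^ (s + suc s) *ℚ x ^ (s * s) *ℚ (c *ℚ i s)
          ≡⟨ solve 4 (λ a b c d → a :* b :* (c :* d) := con 0ℚ :+ c :* a :* (b :* d)) refl (x ^ (s + suc s)) (x ^ (s * s)) c (i s) ⟩
        0ℚ +ℚ c *ℚ x ^ (s + suc s) *ℚ (x ^ (s * s) *ℚ i s)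
          ≡⟨ cong (λ z → 0ℚ +ℚ c *ℚ x ^ (s + suc s) *ℚ z) (T-1-diag s) ⟨
        0ℚ +ℚ c *ℚ x ^ (s + suc s) *ℚ T 1 s s ∎
        where
        open ≡-Reasoning
    -- A partition of a positive number has parts, so s = 0 contributes nothing. For s ≥ 1 the
    -- column takes at least one cell from the old partition and exactly one from the new row, so
    -- the condition on `c` carries over.
    go (suc l) (suc p) h with s ℕ.≟ 0
    ... | yes refl = T-gap-trivial (suc l) (suc p + 0) 0 c (suc (suc l + (suc p + 0))) (suc p + 0 + suc (suc l + (suc p + 0)))
      (T-suc-0 (suc (suc l)) (p + 0))
    ... | no s≢0 = step l (suc p) λ { (s≤s l≤p) → h (ℕ.≤-trans (s≤s (s≤s l≤p)) (ℕ.m<m+n (suc p) (ℕ.n≢0⇒n>0 s≢0))) }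
    go (suc l) zero h = step l zero λ ()
    step l p h = subst₂ _≤_ (sym lhs) (sym (unfold (suc l)))
      (*-monoʳ (0≤x^ (suc s * suc s)) (ℚ.≤-trans (ℚ.≤-reflexive ∑-lhs) (∑-mono (suc s) λ j →
        ℚ.≤-trans (ℚ.≤-reflexive (sym (ℚ.*-distribˡ-+ (i (s ∸ j)) (t l j) (d *ℚ T (suc l) p j))))
          (*-monoʳ (0≤i (s ∸ j)) (T-gap l p j c c≤i₁ h)))))
      where
      open ≡-Reasoning
      t : ℕ → ℕ → ℚ
      t k j = T k (suc (l + p)) (suc j)
      d = c *ℚ x ^ (p + suc (l + p))
      A = ∑ (suc s) (λ j → i (s ∸ j) *ℚ t l j)
      D = ∑ (suc s) (λ j → i (s ∸ j) *ℚ T (suc l) p j)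
      ∑-lhs : A +ℚ d *ℚ D ≡ ∑ (suc s) (λ j → i (s ∸ j) *ℚ t l j +ℚ i (s ∸ j) *ℚ (d *ℚ T (suc l) p j))
      ∑-lhs = begin
        A +ℚ d *ℚ D
          ≡⟨ cong (A +ℚ_) (∑-* (suc s) d (λ j → i (s ∸ j) *ℚ T (suc l) p j)) ⟨
        A +ℚ ∑ (suc s) (λ j → d *ℚ (i (s ∸ j) *ℚ T (suc l) p j))
          ≡⟨ cong (A +ℚ_) (∑-cong (suc s) λ j _ → solve 3 (λ d a b → d :* (a :* b) := a :* (d :* b)) refl d (i (s ∸ j)) (T (suc l) p j)) ⟩
        A +ℚ ∑ (suc s) (λ j → i (s ∸ j) *ℚ (d *ℚ T (suc l) p j))
          ≡⟨ ∑-+ (suc s) (λ j → i (s ∸ j) *ℚ t l j) (λ j → i (s ∸ j) *ℚ (d *ℚ T (suc l) p j)) ⟨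
        ∑ (suc s) (λ j → i (s ∸ j) *ℚ t l j +ℚ i (s ∸ j) *ℚ (d *ℚ T (suc l) p j)) ∎
      unfold : ∀ k → T (suc k) (suc (suc l + (p + s))) (suc s) ≡ x ^ (suc s * suc s) *ℚ ∑ (suc s) (λ j → i (s ∸ j) *ℚ t k j)
      unfold k = begin
        T (suc k) (suc (suc l + (p + s))) (suc s)
          ≡⟨ cong (λ n → T (suc k) (suc (suc n)) (suc s)) (ℕ.+-assoc l p s) ⟨
        T (suc k) (suc (suc (l + p) + s)) (suc s)
          ≡⟨ T-peel k (suc (l + p)) s ⟩
        x ^ (suc s * suc s) *ℚ (i (suc s) *ℚ T k (suc (l + p)) 0 +ℚ ∑ (suc s) (λ j → i (s ∸ j) *ℚ t k j))
          ≡⟨ cong (λ z → x ^ (suc s * suc s) *ℚ (i (suc s) *ℚ z +ℚ ∑ (suc s) (λ j → i (s ∸ j) *ℚ t k j))) (T-suc-0 k (l + p)) ⟩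
        x ^ (suc s * suc s) *ℚ (i (suc s) *ℚ 0ℚ +ℚ ∑ (suc s) (λ j → i (s ∸ j) *ℚ t k j))
          ≡⟨ cong (x ^ (suc s * suc s) *ℚ_) (solve 2 (λ a b → a :* con 0ℚ :+ b := b) refl (i (suc s)) (∑ (suc s) (λ j → i (s ∸ j) *ℚ t k j))) ⟩
        x ^ (suc s * suc s) *ℚ ∑ (suc s) (λ j → i (s ∸ j) *ℚ t k j) ∎
      -- Removing the column lowers m + n by 2s + 1, which is (s+1)² - s².
      exponent : x ^ (p + s + suc (suc l + (p + s))) *ℚ x ^ (s * s) ≡ x ^ (suc s * suc s) *ℚ x ^ (p + suc (l + p))
      exponent = begin
        x ^ (p + s + suc (suc l + (p + s))) *ℚ x ^ (s * s)
          ≡⟨ ^-+ x (p + s + suc (suc l + (p + s))) (s * s) ⟨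
        x ^ (p + s + suc (suc l + (p + s)) + s * s)
          ≡⟨ cong (x ^_) (NS.solve 3 (λ l p s →
               p NS.:+ s NS.:+ (NS.con 2 NS.:+ l NS.:+ (p NS.:+ s)) NS.:+ s NS.:* s NS.:=
               (NS.con 1 NS.:+ s) NS.:* (NS.con 1 NS.:+ s) NS.:+ (p NS.:+ (NS.con 1 NS.:+ (l NS.:+ p)))) refl l p s) ⟩
        x ^ (suc s * suc s + (p + suc (l + p)))
          ≡⟨ ^-+ x (suc s * suc s) (p + suc (l + p)) ⟩
        x ^ (suc s * suc s) *ℚ x ^ (p + suc (l + p)) ∎
      lhs : T (suc l) (suc (suc l + (p + s))) (suc s) +ℚ c *ℚ x ^ (p + s + suc (suc l + (p + s))) *ℚ T (suc (suc l)) (p + s) s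
        ≡ x ^ (suc s * suc s) *ℚ (A +ℚ d *ℚ D)
      lhs = begin
        T (suc l) (suc (suc l + (p + s))) (suc s) +ℚ c *ℚ E *ℚ T (suc (suc l)) (p + s) s
          ≡⟨ cong₂ (λ a b → a +ℚ c *ℚ E *ℚ b) (unfold l) (T-suc (suc l) p s) ⟩
        x ^ (suc s * suc s) *ℚ A +ℚ c *ℚ E *ℚ (x ^ (s * s) *ℚ D)
          ≡⟨ solve 5 (λ a c E f D → a :+ c :* E :* (f :* D) := a :+ (E :* f) :* (c :* D)) refl
               (x ^ (suc s * suc s) *ℚ A) c E (x ^ (s * s)) D ⟩
        x ^ (suc s * suc s) *ℚ A +ℚ (E *ℚ x ^ (s * s)) *ℚ (c *ℚ D)
          ≡⟨ cong (λ z → x ^ (suc s * suc s) *ℚ A +ℚ z *ℚ (c *ℚ D)) exponent ⟩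
        x ^ (suc s * suc s) *ℚ A +ℚ (x ^ (suc s * suc s) *ℚ x ^ (p + suc (l + p))) *ℚ (c *ℚ D)
          ≡⟨ solve 5 (λ s A y c D → s :* A :+ (s :* y) :* (c :* D) := s :* (A :+ c :* y :* D)) refl
               (x ^ (suc s * suc s)) A (x ^ (p + suc (l + p))) c D ⟩
        x ^ (suc s * suc s) *ℚ (A +ℚ d *ℚ D) ∎
        where E = x ^ (p + s + suc (suc l + (p + s)))

  -- The insertion adds one part, so index s for `m` meets index s + 1 for `n`; the sum for `m` is
  -- padded with zeros to equal length.
  S-gap : ∀ l m c → c ≤ i 1 → (l < m → c ≤ 1ℚ) →
    S l (suc (l + m)) +ℚ c *ℚ x ^ (m + suc (l + m)) *ℚ S (suc l) m ≤ S (suc l) (suc (l + m))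
  S-gap l m c c≤i₁ c≤1 = ℚ.≤-trans (ℚ.≤-reflexive lhs)
    (ℚ.+-mono-≤ (T-mono l n 0) (∑-mono n λ s → T-gap l m s c c≤i₁ c≤1))
    where
    open ≡-Reasoning
    n = suc (l + m)
    d = c *ℚ x ^ (m + n)
    lhs : S l n +ℚ d *ℚ S (suc l) m ≡ T l n 0 +ℚ ∑ n (λ s → T l n (suc s) +ℚ d *ℚ T (suc l) m s)
    lhs = begin
      T l n 0 +ℚ ∑ n (λ s → T l n (suc s)) +ℚ d *ℚ S (suc l) m
        ≡⟨ ℚ.+-assoc (T l n 0) _ _ ⟩
      T l n 0 +ℚ (∑ n (λ s → T l n (suc s)) +ℚ d *ℚ S (suc l) m)
        ≡⟨ cong (λ z → T l n 0 +ℚ (∑ n (λ s → T l n (suc s)) +ℚ d *ℚ z))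
             (∑-truncate l (suc m) (T (suc l) m) λ s → T-< (suc l)) ⟨
      T l n 0 +ℚ (∑ n (λ s → T l n (suc s)) +ℚ d *ℚ ∑ (l + suc m) (T (suc l) m))
        ≡⟨ cong (λ k → T l n 0 +ℚ (∑ n (λ s → T l n (suc s)) +ℚ d *ℚ ∑ k (T (suc l) m))) (ℕ.+-suc l m) ⟩
      T l n 0 +ℚ (∑ n (λ s → T l n (suc s)) +ℚ d *ℚ ∑ n (T (suc l) m))
        ≡⟨ cong (λ z → T l n 0 +ℚ (∑ n (λ s → T l n (suc s)) +ℚ z)) (∑-* n d (T (suc l) m)) ⟨
      T l n 0 +ℚ (∑ n (λ s → T l n (suc s)) +ℚ ∑ n (λ s → d *ℚ T (suc l) m s))
        ≡⟨ cong (T l n 0 +ℚ_) (∑-+ n (λ s → T l n (suc s)) (λ s → d *ℚ T (suc l) m s)) ⟨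
      T l n 0 +ℚ ∑ n (λ s → T l n (suc s) +ℚ d *ℚ T (suc l) m s) ∎

  S-mono : ∀ {k l} n → k ℕ.≤ l → S k n ≤ S l n
  S-mono {k} n k≤l = go (ℕ.≤⇒≤′ k≤l)
    where
    go : ∀ {l} → k ℕ.≤′ l → S k n ≤ S l n
    go (ℕ.≤′-reflexive refl) = ℚ.≤-refl
    go (ℕ.≤′-step {l} k≤l) = ℚ.≤-trans (go k≤l) (∑-mono (suc n) (T-mono l n))

  0≤S : ∀ k n → 0ℚ ≤ S k n
  0≤S k n = ∑-nonneg (suc n) (0≤T k n)

  -- The constant 1/(1 - x) and quotients of q-factorials

  u : ℚ
  u = i 1

  0≤u : 0ℚ ≤ u
  0≤u = 0≤i 1

  u-eq : u *ℚ (1ℚ - x) ≡ 1ℚ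
  u-eq = begin
    u *ℚ (1ℚ - x)       ≡⟨ cong (λ z → u *ℚ (1ℚ - z)) (ℚ.*-identityʳ x) ⟨
    u *ℚ (1ℚ - x ^ 1)   ≡⟨ i-suc 0 ⟨
    i 0                 ≡⟨ i-0 ⟩
    1ℚ                  ∎
    where open ≡-Reasoning

  -- The defining relation of `u` in the shape that `≡-modulo` takes; in use it mostly means u = 1 +
  -- ux.
  u≡0 : u *ℚ (1ℚ - x) - 1ℚ ≡ 0ℚ
  u≡0 = cong (_- 1ℚ) u-eq

  1≤u : 1ℚ ≤ u
  1≤u = subst (_≤ u) i-0 (i≤i-suc 0)

  u*x≤1 : u *ℚ x ≤ 1ℚ
  u*x≤1 = ℚ.≤-trans (*-monoʳ 0≤u x≤1-x) (ℚ.≤-reflexive u-eq)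

  x^≤1 : ∀ k → x ^ k ≤ 1ℚ
  x^≤1 k = x^-antitone {0} {k} z≤n

  -- The quotient is the product of 1 - x^j over M < j ≤ d + M. A product of factors 1 - a_j with
  -- a_j in [0,1] is at least 1 - Σ a_j, and here Σ a_j is geometric. The upper bound is carried
  -- along because the induction step for the lower one needs it.
  ratio : ∀ d M → (1ℚ - (u *ℚ x ^ suc M - u *ℚ x ^ suc (d + M)) ≤ φ x (d + M) *ℚ i M) × (φ x (d + M) *ℚ i M ≤ 1ℚ)
  ratio zero M = ℚ.≤-reflexive (trans
      (solve 1 (λ a → con 1ℚ :- (a :- a) := con 1ℚ) refl (u *ℚ x ^ suc M)) (sym (φ*i M)))
    , ℚ.≤-reflexive (φ*i M)
  ratio (suc d) M with ratio d M
  ... | lo , hi = ℚ.≤-trans (≤-from-gap g 0≤g eq) (ℚ.≤-reflexive (sym unfold))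
                , ℚ.≤-trans (≤-from-gap (R *ℚ y) (0≤* 0≤R 0≤y) (trans
                    (solve 2 (λ R y → R := R :* (con 1ℚ :- y) :+ R :* y) refl R y) (cong (_+ℚ R *ℚ y) (sym unfold)))) hi
    where
    y = x ^ suc (d + M)
    R = φ x (d + M) *ℚ i M
    a = x ^ suc M
    0≤y : 0ℚ ≤ y
    0≤y = 0≤x^ (suc (d + M))
    0≤R : 0ℚ ≤ R
    0≤R = 0≤* (ℚ.<⇒≤ (0<φ (d + M))) (0≤i M)
    unfold : φ x (suc d + M) *ℚ i M ≡ R *ℚ (1ℚ - y)
    unfold = solve 3 (λ f y i → f :* y :* i := f :* i :* y) refl (φ x (d + M)) (1ℚ - y) (i M)
    g = (R - (1ℚ - (u *ℚ a - u *ℚ y))) +ℚ (1ℚ - R) *ℚ y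
    0≤g : 0ℚ ≤ g
    0≤g = 0≤+ (gap lo) (0≤* (gap hi) 0≤y)
    eq : R *ℚ (1ℚ - y) ≡ 1ℚ - (u *ℚ a - u *ℚ (x *ℚ y)) +ℚ g
    eq = ≡-modulo _ y u≡0 (solve 5 (λ R y u a x → R :* (con 1ℚ :- y) :=
           con 1ℚ :- (u :* a :- u :* (x :* y)) :+ ((R :- (con 1ℚ :- (u :* a :- u :* y))) :+ (con 1ℚ :- R) :* y)
             :+ (u :* (con 1ℚ :- x) :- con 1ℚ) :* y) refl R y u a x)

  -- i 1 · Σ_{m ≤ M} x^(2m) · i m in closed form.
  E : ℕ → ℚ
  E M = i M *ℚ (1ℚ +ℚ u *ℚ x ^ suc M)

  -- With y = x^(M+1) and i(M) = i(M+1)(1 - y), the difference is i(M+1) y (ux + 1 - u + uy), and u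
  -- = 1 + ux leaves u y² i(M+1).
  E-suc : ∀ M → E (suc M) ≡ E M +ℚ u *ℚ (x ^ suc M *ℚ x ^ suc M) *ℚ i (suc M)
  E-suc M = ≡-modulo _ (- (i (suc M) *ℚ y)) u≡0 (trans
    (solve 4 (λ i u x y → i :* (con 1ℚ :+ u :* (x :* y)) :=
      (i :* (con 1ℚ :- y)) :* (con 1ℚ :+ u :* y) :+ u :* (y :* y) :* i :+ (u :* (con 1ℚ :- x) :- con 1ℚ) :* (:- (i :* y)))
      refl (i (suc M)) u x y)
    (cong (λ z → z *ℚ (1ℚ +ℚ u *ℚ y) +ℚ u *ℚ (y *ℚ y) *ℚ i (suc M) +ℚ (u *ℚ (1ℚ - x) - 1ℚ) *ℚ (- (i (suc M) *ℚ y))) (sym (i-suc M))))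
    where y = x ^ suc M

  E-0 : E 0 ≡ u
  E-0 = ≡-modulo _ (- 1ℚ) u≡0 (trans (cong₂ (λ a b → a *ℚ (1ℚ +ℚ u *ℚ b)) i-0 (ℚ.*-identityʳ x))
    (solve 2 (λ u x → con 1ℚ :* (con 1ℚ :+ u :* x) := u :+ (u :* (con 1ℚ :- x) :- con 1ℚ) :* (:- con 1ℚ)) refl u x))

  -- The upper bound

  -- The possible largest parts l + 1, ..., n are split off from the total. The one leaving m cells
  -- for the other rows accounts for at least x^n u x^(2m) i(m), and m runs from M down to 0, which
  -- adds up to x^n E(M).
  S-upper : ∀ M l → M ℕ.≤ l → S l (suc (l + M)) ≤ x ^ suc (l + M) *ℚ (i (suc (l + M)) - E M)
  S-upper zero l _ = ≤-from-gap (g - s) (gap (ℚ.≤-trans (S-gap l 0 u ℚ.≤-refl λ ()) (ℚ.≤-reflexive (S-closed (suc l) n (ℕ.≤-reflexive (cong suc (ℕ.+-identityʳ l)))))))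
    (trans (cong (λ z → x ^ n *ℚ (i n - z)) E-0) (trans
      (solve 4 (λ X I u S → X :* (I :- u) := S :+ (X :* I :- (S :+ u :* X :* (con 1ℚ :* con 1ℚ)))) refl (x ^ n) (i n) u (S l n))
      (cong (λ z → S l n +ℚ (g - (S l n +ℚ u *ℚ x ^ n *ℚ z))) (sym (trans (S-closed (suc l) 0 z≤n) (cong (1ℚ *ℚ_) i-0))))))
    where
    n = suc (l + 0)
    g = x ^ n *ℚ i n
    s = S l n +ℚ u *ℚ x ^ n *ℚ S (suc l) 0
  S-upper (suc M) l M<l = ≤-from-gap _ (0≤+ (gap (S-gap l (suc M) u ℚ.≤-refl λ l<M → contradiction l<M (ℕ.≤⇒≯ M<l))) (gap IH)) eq
    where
    n = suc (l + suc M)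
    y = x ^ suc M
    IH : S (suc l) n ≤ x ^ n *ℚ (i n - E M)
    IH = subst (λ n → S (suc l) n ≤ x ^ n *ℚ (i n - E M)) (cong suc (sym (ℕ.+-suc l M)))
      (S-upper M (suc l) (ℕ.≤-trans (ℕ.n≤1+n M) (ℕ.m≤n⇒m≤1+n M<l)))
    eq : x ^ n *ℚ (i n - E (suc M)) ≡ S l n +ℚ
      ((S (suc l) n - (S l n +ℚ u *ℚ x ^ (suc M + n) *ℚ S (suc l) (suc M))) +ℚ (x ^ n *ℚ (i n - E M) - S (suc l) n))
    eq = begin
      x ^ n *ℚ (i n - E (suc M))
        ≡⟨ cong (λ z → x ^ n *ℚ (i n - z)) (E-suc M) ⟩
      x ^ n *ℚ (i n - (E M +ℚ u *ℚ (y *ℚ y) *ℚ i (suc M)))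
        ≡⟨ solve 8 (λ X I e u y j S S' → X :* (I :- (e :+ u :* (y :* y) :* j)) :=
             S :+ ((S' :- (S :+ u :* (y :* X) :* (y :* j))) :+ (X :* (I :- e) :- S')))
             refl (x ^ n) (i n) (E M) u y (i (suc M)) (S l n) (S (suc l) n) ⟩
      S l n +ℚ ((S (suc l) n - (S l n +ℚ u *ℚ (y *ℚ x ^ n) *ℚ (y *ℚ i (suc M)))) +ℚ (x ^ n *ℚ (i n - E M) - S (suc l) n))
        ≡⟨ cong₂ (λ a b → S l n +ℚ ((S (suc l) n - (S l n +ℚ u *ℚ a *ℚ b)) +ℚ (x ^ n *ℚ (i n - E M) - S (suc l) n)))
             (^-+ x (suc M) n) (S-closed (suc l) (suc M) (ℕ.m≤n⇒m≤1+n M<l)) ⟨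
      S l n +ℚ ((S (suc l) n - (S l n +ℚ u *ℚ x ^ (suc M + n) *ℚ S (suc l) (suc M))) +ℚ (x ^ n *ℚ (i n - E M) - S (suc l) n)) ∎
      where open ≡-Reasoning

  0≤φ : ∀ n → 0ℚ ≤ φ x n
  0≤φ n = ℚ.<⇒≤ (0<φ n)

  -- φ(n) i(n) = 1 and φ(n) i(M) ≥ 1 - (b - c) give 1 - (1 - b + c)(1 + b): the terms linear in b
  -- cancel.
  φS-upper : ∀ M l → M ℕ.≤ l → let n = suc (l + M) ; b = u *ℚ x ^ suc M ; c = u *ℚ x ^ suc n in
    φ x n *ℚ S l n ≤ x ^ n *ℚ (b *ℚ b - c *ℚ (1ℚ +ℚ b))
  φS-upper M l M≤l = ℚ.≤-trans (*-monoʳ (0≤φ n) (S-upper M l M≤l)) (≤-from-gap _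
    (0≤* (0≤x^ n) (0≤* (gap (proj₁ (ratio (suc l) M))) (0≤+ 0≤1 (0≤* 0≤u (0≤x^ (suc M)))))) eq)
    where
    n = suc (l + M)
    b = u *ℚ x ^ suc M
    c = u *ℚ x ^ suc n
    f = φ x n
    eq : x ^ n *ℚ (b *ℚ b - c *ℚ (1ℚ +ℚ b)) ≡
      f *ℚ (x ^ n *ℚ (i n - E M)) +ℚ x ^ n *ℚ ((f *ℚ i M - (1ℚ - (b - c))) *ℚ (1ℚ +ℚ b))
    eq = ≡-modulo _ (- (x ^ n)) (cong (_- 1ℚ) (φ*i n))
      (solve 6 (λ X b c f j k → X :* (b :* b :- c :* (con 1ℚ :+ b)) :=
        f :* (X :* (k :- j :* (con 1ℚ :+ b))) :+ X :* ((f :* j :- (con 1ℚ :- (b :- c))) :* (con 1ℚ :+ b))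
          :+ (f :* k :- con 1ℚ) :* (:- X)) refl (x ^ n) b c f (i M) (i n))

  φS-upper-large : ∀ M l → M ℕ.≤ l → let n = suc (l + M) ; b = u *ℚ x ^ suc M in
    φ x n *ℚ S l n ≤ x ^ n *ℚ (b *ℚ b)
  φS-upper-large M l M≤l = ℚ.≤-trans (φS-upper M l M≤l) (*-monoʳ (0≤x^ n)
    (≤-from-gap (c *ℚ (1ℚ +ℚ b)) (0≤* (0≤* 0≤u (0≤x^ (suc n))) (0≤+ 0≤1 (0≤* 0≤u (0≤x^ (suc M)))))
      (solve 2 (λ p q → p := p :- q :+ q) refl (b *ℚ b) (c *ℚ (1ℚ +ℚ b)))))
    where
    n = suc (l + M)
    b = u *ℚ x ^ suc M
    c = u *ℚ x ^ suc n

  -- Here n = 2h with h = l + 1. From `φS-upper` for parts at most h, the weight of λ₁ = h is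
  -- subtracted; h may occur twice, so only the factor 1 is available. The term - c(1 + b) is
  -- essential now: the leading coefficient becomes u² - ux - 1, which equals u²x.
  φS-upper-half : ∀ l → let n = suc (l + suc l) in φ x n *ℚ S l n ≤ x ^ n *ℚ (u *ℚ u *ℚ x ^ suc n)
  φS-upper-half l = ≤-from-gap _ (0≤+ (0≤+ (0≤+
      (gap (subst (λ n → φ x n *ℚ S (suc l) n ≤ x ^ n *ℚ (u *ℚ y *ℚ (u *ℚ y) - u *ℚ x ^ suc n *ℚ (1ℚ +ℚ u *ℚ y)))
        (cong suc (sym (ℕ.+-suc l l))) (φS-upper l (suc l) (ℕ.n≤1+n l))))
      (0≤* (0≤φ n) (gap (S-gap l h 1ℚ 1≤u λ _ → ℚ.≤-refl))))
      (0≤* (0≤* 0≤X 0≤X) (gap (proj₁ (ratio h h)))))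
      (0≤* (0≤* 0≤X 0≤X) (0≤+ (0≤* (0≤* 0≤u (0≤x^ (suc h))) (0≤* 0≤u 0≤x)) (0≤* 0≤u (0≤x^ (suc n)))))) eq
    where
    h = suc l
    n = suc (l + suc l)
    y = x ^ h
    X = x ^ n
    f = φ x n
    0≤X : 0ℚ ≤ X
    0≤X = 0≤x^ n
    eq : X *ℚ (u *ℚ u *ℚ x ^ suc n) ≡ f *ℚ S l n +ℚ
      (((X *ℚ (u *ℚ y *ℚ (u *ℚ y) - u *ℚ x ^ suc n *ℚ (1ℚ +ℚ u *ℚ y)) - f *ℚ S h n)
        +ℚ f *ℚ (S h n - (S l n +ℚ 1ℚ *ℚ x ^ (h + n) *ℚ S h h)))
        +ℚ X *ℚ X *ℚ (f *ℚ i h - (1ℚ - (u *ℚ x ^ suc h - u *ℚ x ^ suc n)))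
        +ℚ X *ℚ X *ℚ (u *ℚ x ^ suc h *ℚ (u *ℚ x) +ℚ u *ℚ x ^ suc n))
    poly : (p q X : ℚ) → ℚ
    poly p q X = f *ℚ S l n +ℚ
      (((X *ℚ (u *ℚ y *ℚ (u *ℚ y) - u *ℚ (x *ℚ X) *ℚ (1ℚ +ℚ u *ℚ y)) - f *ℚ S h n)
        +ℚ f *ℚ (S h n - (S l n +ℚ 1ℚ *ℚ p *ℚ q)))
        +ℚ X *ℚ X *ℚ (f *ℚ i h - (1ℚ - (u *ℚ (x *ℚ y) - u *ℚ (x *ℚ X))))
        +ℚ X *ℚ X *ℚ (u *ℚ (x *ℚ y) *ℚ (u *ℚ x) +ℚ u *ℚ (x *ℚ X)))
    eq = trans
      (subst (λ X → X *ℚ (u *ℚ u *ℚ (x *ℚ X)) ≡ poly (y *ℚ X) (y *ℚ i h) X) (sym (^-+ x h h))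
        (≡-modulo _ (y *ℚ y *ℚ (y *ℚ y) *ℚ (u *ℚ x *ℚ y - u - 1ℚ)) u≡0
          (solve 7 (λ u x y f S S' I → let X = y :* y in
            X :* (u :* u :* (x :* X)) := f :* S :+
              (((X :* (u :* y :* (u :* y) :- u :* (x :* X) :* (con 1ℚ :+ u :* y)) :- f :* S')
                :+ f :* (S' :- (S :+ con 1ℚ :* (y :* X) :* (y :* I))))
                :+ X :* X :* (f :* I :- (con 1ℚ :- (u :* (x :* y) :- u :* (x :* X))))
                :+ X :* X :* (u :* (x :* y) :* (u :* x) :+ u :* (x :* X)))
              :+ (u :* (con 1ℚ :- x) :- con 1ℚ) :* (X :* X :* (u :* x :* y :- u :- con 1ℚ)))
            refl u x y f (S l n) (S h n) (i h))))
      (cong₂ (λ p q → poly p q X) (sym (^-+ x h n)) (sym (S-closed h h ℕ.≤-refl)))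

  -- The two summands serve two ranges: the first bounds the case M ≤ l, the second the case of
  -- smaller l, where the parts are allowed to grow up to ⌈n/2⌉ - 1. Their sum covers both.
  φS-≤ : ∀ l M → let n = l + suc M in
    φ x n *ℚ S l n ≤ x ^ n *ℚ (u *ℚ u *ℚ (x ^ (suc M + suc M) +ℚ x ^ suc n))
  φS-≤ l M with M ℕ.≤? l
  ... | yes M≤l rewrite ℕ.+-suc l M = ℚ.≤-trans (φS-upper-large M l M≤l) (*-monoʳ (0≤x^ (suc (l + M)))
    (≤-from-gap _ (0≤* (0≤* 0≤u 0≤u) (0≤x^ (suc (suc (l + M)))))
      (trans (cong (λ z → u *ℚ u *ℚ (z +ℚ x ^ suc (suc (l + M)))) (^-+ x (suc M) (suc M)))
        (solve 3 (λ u y w → u :* u :* (y :* y :+ w) := u :* y :* (u :* y) :+ u :* u :* w) refl u (x ^ suc M) (x ^ suc (suc (l + M)))))))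
  ... | no M≰l = ℚ.≤-trans x^suc-bound (*-monoʳ (0≤x^ n)
    (≤-from-gap _ (0≤* (0≤* 0≤u 0≤u) (0≤x^ (suc M + suc M)))
      (solve 3 (λ u a b → u :* u :* (a :+ b) := u :* u :* b :+ u :* u :* a) refl u (x ^ (suc M + suc M)) (x ^ suc n))))
    where
    n = l + suc M
    l<M : l < M
    l<M = ℕ.≰⇒> M≰l
    x^suc-bound : φ x n *ℚ S l n ≤ x ^ n *ℚ (u *ℚ u *ℚ x ^ suc n)
    x^suc-bound with even-or-odd (l + M)
    -- n = 2h + 1, and the leading exponent at h is 2(h + 1) = n + 1.
    ... | h , inj₁ l+M≡h+h rewrite trans (ℕ.+-suc l M) (cong suc l+M≡h+h) =
      ℚ.≤-trans (*-monoʳ (0≤φ (suc (h + h))) (S-mono (suc (h + h)) l≤h))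
        (ℚ.≤-trans (φS-upper-large h h ℕ.≤-refl) (ℚ.≤-reflexive (cong (x ^ suc (h + h) *ℚ_) b*b)))
      where
      b*b : u *ℚ x ^ suc h *ℚ (u *ℚ x ^ suc h) ≡ u *ℚ u *ℚ x ^ suc (suc (h + h))
      b*b = begin
        u *ℚ x ^ suc h *ℚ (u *ℚ x ^ suc h)    ≡⟨ solve 2 (λ u y → u :* y :* (u :* y) := u :* u :* (y :* y)) refl u (x ^ suc h) ⟩
        u *ℚ u *ℚ (x ^ suc h *ℚ x ^ suc h)    ≡⟨ cong (u *ℚ u *ℚ_) (^-+ x (suc h) (suc h)) ⟨
        u *ℚ u *ℚ x ^ (suc h + suc h)         ≡⟨ cong (λ k → u *ℚ u *ℚ x ^ suc k) (ℕ.+-suc h h) ⟩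
        u *ℚ u *ℚ x ^ suc (suc (h + h))       ∎
        where open ≡-Reasoning
      l≤h : l ℕ.≤ h
      l≤h = ℕ.≮⇒≥ λ h<l → ℕ.<-irrefl (sym l+M≡h+h) (ℕ.+-mono-< h<l (ℕ.<-trans h<l l<M))
    -- n = 2h + 2, so n/2 = h + 1 must itself be excluded.
    ... | h , inj₂ l+M≡1+h+h rewrite trans (ℕ.+-suc l M) (cong suc (trans l+M≡1+h+h (sym (ℕ.+-suc h h)))) =
      ℚ.≤-trans (*-monoʳ (0≤φ (suc (h + suc h))) (S-mono (suc (h + suc h)) l≤h)) (φS-upper-half h)
      where
      l≤h : l ℕ.≤ h
      l≤h = ℕ.≮⇒≥ λ h<l → ℕ.<-irrefl (sym l+M≡1+h+h)
        (ℕ.≤-trans (ℕ.≤-reflexive (cong suc (sym (ℕ.+-suc h h)))) (ℕ.+-mono-≤ h<l (ℕ.<-trans h<l l<M)))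

  -- The lower bound

  -- The partitions with λ₁ = l + 1 weigh at least c x^(m+n) x^m i(m), and `ratio` bounds φ(n) i(m)
  -- below by 1 - u x^(m+1). The constant `c` will be `u` if l + 1 can occur only once, and 1
  -- otherwise.
  φS-core : ∀ l m c → m ℕ.≤ suc l → 0ℚ ≤ c → c ≤ u → (l < m → c ≤ 1ℚ) → let n = suc (l + m) in
    x ^ n *ℚ (c *ℚ x ^ (m + m) *ℚ (1ℚ - u *ℚ x ^ suc m)) ≤ φ x n *ℚ S (suc l) n
  φS-core l m c m≤1+l 0≤c c≤u c≤1 = ≤-from-gap _
    (0≤+ (0≤+ (0≤+ (0≤* (0≤φ n) (gap (S-gap l m c c≤u c≤1))) (0≤* (0≤φ n) (0≤S l n)))
      (0≤* 0≤k (gap (proj₁ (ratio (suc l) m))))) (0≤* 0≤k (0≤* 0≤u (0≤x^ (suc n))))) eq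
    where
    n = suc (l + m)
    f = φ x n
    y = x ^ m
    X = x ^ n
    k = X *ℚ (c *ℚ x ^ (m + m))
    0≤k : 0ℚ ≤ k
    0≤k = 0≤* (0≤x^ n) (0≤* 0≤c (0≤x^ (m + m)))
    poly : (p q r : ℚ) → ℚ
    poly p q r = f *ℚ (S (suc l) n - (S l n +ℚ c *ℚ p *ℚ q)) +ℚ f *ℚ S l n
      +ℚ X *ℚ (c *ℚ r) *ℚ (f *ℚ i m - (1ℚ - (u *ℚ x ^ suc m - u *ℚ x ^ suc n)))
      +ℚ X *ℚ (c *ℚ r) *ℚ (u *ℚ x ^ suc n)
    eq : f *ℚ S (suc l) n ≡ X *ℚ (c *ℚ x ^ (m + m) *ℚ (1ℚ - u *ℚ x ^ suc m))
      +ℚ poly (x ^ (m + n)) (S (suc l) m) (x ^ (m + m))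
    eq = trans
      (subst (λ r → f *ℚ S (suc l) n ≡ X *ℚ (c *ℚ r *ℚ (1ℚ - u *ℚ x ^ suc m)) +ℚ poly (y *ℚ X) (y *ℚ i m) r)
        (sym (^-+ x m m))
        (solve 10 (λ X c y f S S' I u a b →
          f :* S' := X :* (c :* (y :* y) :* (con 1ℚ :- u :* a)) :+
            (f :* (S' :- (S :+ c :* (y :* X) :* (y :* I))) :+ f :* S
              :+ X :* (c :* (y :* y)) :* (f :* I :- (con 1ℚ :- (u :* a :- u :* b)))
              :+ X :* (c :* (y :* y)) :* (u :* b)))
          refl X c y f (S l n) (S (suc l) n) (i m) u (x ^ suc m) (x ^ suc n)))
      (cong₂ (λ p q → X *ℚ (c *ℚ x ^ (m + m) *ℚ (1ℚ - u *ℚ x ^ suc m)) +ℚ poly p q (x ^ (m + m)))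
        (sym (^-+ x m n)) (sym (S-closed (suc l) m m≤1+l)))

  φS-≥ : ∀ l m → 0 < m → let n = l + m in
    x ^ n *ℚ (x ^ (m + m) - u *ℚ x ^ suc n) ≤ φ x n *ℚ S l n
  φS-≥ l m 0<m with m ℕ.≤? l
  -- Since n + 1 ≤ 2m and u ≥ 1, the left side is not positive.
  φS-≥ l m 0<m | no m≰l = ℚ.≤-trans
    (≤-from-gap _ (0≤* (0≤x^ n) (0≤+ (0≤* (gap 1≤u) (0≤x^ (suc n))) (gap (x^-antitone 1+n≤m+m))))
      (solve 4 (λ X u y z → con 0ℚ := X :* (z :- u :* y) :+ X :* ((u :- con 1ℚ) :* y :+ (y :- z))) refl
        (x ^ n) u (x ^ suc n) (x ^ (m + m))))
    (0≤* (0≤φ n) (0≤S l n))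
    where
    n = l + m
    1+n≤m+m : suc n ℕ.≤ m + m
    1+n≤m+m = ℕ.+-monoˡ-≤ m (ℕ.≰⇒> m≰l)
  φS-≥ zero m 0<m | yes m≤0 = contradiction m≤0 (ℕ.<⇒≱ 0<m)
  φS-≥ (suc l) m 0<m | yes m≤1+l with m ℕ.≤? l
  -- With c = u = 1 + ux the surplus ux pays for the loss u² x^(m+1), because u x^m ≤ ux ≤ 1; the
  -- last inequality is x ≤ 1/2.
  ... | yes m≤l = ℚ.≤-trans (*-monoʳ (0≤x^ n) (≤-from-gap _ (0≤+ (0≤* 0≤u (0≤x^ (suc n)))
      (0≤* (0≤x^ (m + m)) (0≤* (0≤* 0≤u 0≤x) (gap u*y≤1))))
      (≡-modulo _ (x ^ (m + m)) u≡0 (solve 5 (λ u x y z w →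
        u :* z :* (con 1ℚ :- u :* (x :* y)) := z :- u :* w :+ (u :* w :+ z :* (u :* x :* (con 1ℚ :- u :* y)))
          :+ (u :* (con 1ℚ :- x) :- con 1ℚ) :* z) refl u x (x ^ m) (x ^ (m + m)) (x ^ suc n)))))
    (φS-core l m u m≤1+l 0≤u ℚ.≤-refl λ l<m → contradiction m≤l (ℕ.<⇒≱ l<m))
    where
    n = suc (l + m)
    u*y≤1 : u *ℚ x ^ m ≤ 1ℚ
    u*y≤1 = ℚ.≤-trans (*-monoʳ 0≤u (ℚ.≤-trans (x^-antitone 0<m) (ℚ.≤-reflexive (ℚ.*-identityʳ x)))) u*x≤1
  ... | no m≰l with ℕ.≤-antisym m≤1+l (ℕ.≰⇒> m≰l)
  -- Here n = 2m and c = 1; the loss u x^(3m+1) is at most u x^(n+1).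
  ... | refl = ℚ.≤-trans (*-monoʳ (0≤x^ n) (≤-from-gap _ (0≤* (0≤* 0≤u (0≤x^ (suc n))) (gap (x^≤1 m)))
      (solve 4 (λ u x y z → con 1ℚ :* z :* (con 1ℚ :- u :* (x :* y)) :=
        z :- u :* (x :* z) :+ u :* (x :* z) :* (con 1ℚ :- y)) refl u x (x ^ m) (x ^ n))))
    (φS-core l m 1ℚ m≤1+l 0≤1 1≤u λ _ → ℚ.≤-refl)
    where
    n = suc (l + m)

  -- The recursion for weights realised on multiplicity vectors

  wt : ∀ {k} → Vec ℕ k → ℚ
  wt []      = 1ℚ
  wt (a ∷ v) = x ^ ((a + tot v) * (a + tot v)) *ℚ i a *ℚ wt v

  gate : ∀ {k} → ℕ → ℕ → Vec ℕ k → ℚ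
  gate L n v = if (size v ≡ᵇ n) ∧ small v L then wt v else 0ℚ

  gated : ∀ {k} → ℕ → ℕ → ℕ → Vec ℕ k → ℚ
  gated L n s v = if tot v ≡ᵇ s then gate L n v else 0ℚ

  gated-≢ : ∀ {k} L n s (v : Vec ℕ k) → tot v ≢ s → gated L n s v ≡ 0ℚ
  gated-≢ L n s v t≢s rewrite ≢⇒≡ᵇ-false t≢s = refl

  gated-≡ : ∀ {k} L n (v : Vec ℕ k) → gated L n (tot v) v ≡ gate L n v
  gated-≡ L n v rewrite ≡ᵇ-refl (tot v) = refl

  gate-> : ∀ {k} L n (v : Vec ℕ k) → n < tot v → gate L n v ≡ 0ℚ
  gate-> L n v n<t rewrite ≢⇒≡ᵇ-false {size v} {n} (λ { refl → ℕ.<-irrefl refl (ℕ.<-≤-trans n<t (tot≤size v)) }) = refl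

  gated-> : ∀ {k} L n s (v : Vec ℕ k) → n < s → gated L n s v ≡ 0ℚ
  gated-> L n s v n<s with tot v ℕ.≟ s
  ... | yes refl = trans (gated-≡ L n v) (gate-> L n v n<s)
  ... | no  t≢s  = gated-≢ L n s v t≢s

  gate-∷ : ∀ {k} L m a (v : Vec ℕ k) → let s = a + tot v in
    gate (suc L) (m + s) (a ∷ v) ≡ x ^ (s * s) *ℚ i a *ℚ gate L m v
  gate-∷ L m a v rewrite size-∷ a v | +-cancel-≡ᵇ (a + tot v) (size v) m with (size v ≡ᵇ m) ∧ small v L
  ... | true  = refl
  ... | false = sym (ℚ.*-zeroʳ (x ^ ((a + tot v) * (a + tot v)) *ℚ i a))

  small-zero : ∀ {k} (v : Vec ℕ k) → small v 0 ≡ true → tot v ≡ 0 × size v ≡ 0 × wt v ≡ 1ℚ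
  small-zero []         _  = refl , refl , refl
  small-zero (zero ∷ v) sm with small-zero v sm
  ... | t≡0 , s≡0 , w≡1 = t≡0 , trans (size-∷ 0 v) (cong₂ _+_ t≡0 s≡0)
    , trans (cong₂ (λ t w → x ^ (t * t) *ℚ i 0 *ℚ w) t≡0 w≡1) (cong (λ z → 1ℚ *ℚ z *ℚ 1ℚ) i-0)

  gated-0 : ∀ {k} n s (v : Vec ℕ k) → gated 0 n s v ≡ (if small v 0 then T 0 n s else 0ℚ)
  gated-0 n s v with small v 0 in eq
  ... | false rewrite Bool.∧-zeroʳ (size v ≡ᵇ n) = Bool.if-eta (tot v ≡ᵇ s)
  ... | true with small-zero v eq
  ...   | t≡0 , s≡0 , w≡1 rewrite t≡0 | s≡0 | w≡1 = indicator n s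
    where
    indicator : ∀ n s → (if 0 ≡ᵇ s then if (0 ≡ᵇ n) ∧ true then 1ℚ else 0ℚ else 0ℚ) ≡ T 0 n s
    indicator zero    zero    = refl
    indicator zero    (suc s) = refl
    indicator (suc n) zero    = refl
    indicator (suc n) (suc s) = refl

  vsum-small-0 : ∀ k b c → vsum k b (λ v → if small v 0 then c else 0ℚ) ≡ c
  vsum-small-0 zero    b c = refl
  vsum-small-0 (suc k) b c = trans
    (vsum-cong k b λ v → trans (cong ((if small v 0 then c else 0ℚ) +ℚ_) (∑-zero b λ _ _ → refl)) (ℚ.+-identityʳ _))
    (vsum-small-0 k b c)

  -- For a fixed tail `v` both sides have at most one nonzero term: the head must be s - `tot v`,
  -- and in the recursion j must be `tot v`. The bound n ≤ b keeps this head within the enumerated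
  -- range.
  vsum-gated : ∀ k b L n s → n ℕ.≤ b → L ℕ.≤ k → vsum k b (gated L n s) ≡ T L n s
  vsum-gated k b zero n s n≤b _ = trans (vsum-cong k b (gated-0 n s)) (vsum-small-0 k b (T 0 n s))
  vsum-gated (suc k) b (suc L) n s n≤b (s≤s L≤k) with s ℕ.≤? n
  ... | no s≰n = trans (vsum-cong k b λ v → ∑-zero (suc b) λ a _ → gated-> (suc L) n s (a ∷ v) (ℕ.≰⇒> s≰n))
                       (trans (vsum-zero k b) (sym (T-< (suc L) (ℕ.≰⇒> s≰n))))
  ... | yes s≤n = subst (λ n → n ℕ.≤ b → vsum (suc k) b (gated (suc L) n s) ≡ T (suc L) n s) (ℕ.m∸n+n≡m s≤n) (go (n ∸ s)) n≤b
    where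
    open ≡-Reasoning
    go : ∀ m → m + s ℕ.≤ b → vsum (suc k) b (gated (suc L) (m + s) s) ≡ T (suc L) (m + s) s
    go m m+s≤b = begin
      vsum k b (λ v → ∑ (suc b) λ a → gated (suc L) (m + s) s (a ∷ v))
        ≡⟨ vsum-cong k b column ⟩
      vsum k b (λ v → x ^ (s * s) *ℚ ∑ (suc s) λ j → i (s ∸ j) *ℚ gated L m j v)
        ≡⟨ vsum-* k b (x ^ (s * s)) (λ v → ∑ (suc s) λ j → i (s ∸ j) *ℚ gated L m j v) ⟩
      x ^ (s * s) *ℚ vsum k b (λ v → ∑ (suc s) λ j → i (s ∸ j) *ℚ gated L m j v)
        ≡⟨ cong (x ^ (s * s) *ℚ_) (vsum-∑ k b (suc s) λ v j → i (s ∸ j) *ℚ gated L m j v) ⟩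
      x ^ (s * s) *ℚ ∑ (suc s) (λ j → vsum k b λ v → i (s ∸ j) *ℚ gated L m j v)
        ≡⟨ cong (x ^ (s * s) *ℚ_) (∑-cong (suc s) λ j _ → trans (vsum-* k b (i (s ∸ j)) (gated L m j))
             (cong (i (s ∸ j) *ℚ_) (vsum-gated k b L m j (ℕ.≤-trans (ℕ.m≤m+n m s) m+s≤b) L≤k))) ⟩
      x ^ (s * s) *ℚ ∑ (suc s) (λ j → i (s ∸ j) *ℚ T L m j)
        ≡⟨ T-suc L m s ⟨
      T (suc L) (m + s) s ∎
      where
      column : ∀ v → ∑ (suc b) (λ a → gated (suc L) (m + s) s (a ∷ v)) ≡
        x ^ (s * s) *ℚ ∑ (suc s) λ j → i (s ∸ j) *ℚ gated L m j v
      column v with tot v ℕ.≤? s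
      ... | no t≰s = trans
        (∑-zero (suc b) λ a _ → gated-≢ (suc L) (m + s) s (a ∷ v) λ eq → t≰s (subst (tot v ℕ.≤_) eq (ℕ.m≤n+m (tot v) a)))
        (sym (trans (cong (x ^ (s * s) *ℚ_) (∑-zero (suc s) λ { j (s≤s j≤s) →
            trans (cong (i (s ∸ j) *ℚ_) (gated-≢ L m j v λ eq → t≰s (subst (ℕ._≤ s) (sym eq) j≤s))) (ℚ.*-zeroʳ (i (s ∸ j))) }))
          (ℚ.*-zeroʳ (x ^ (s * s)))))
      ... | yes t≤s = begin
        ∑ (suc b) (λ a → gated (suc L) (m + s) s (a ∷ v))
          ≡⟨ ∑-single (s≤s (ℕ.≤-trans (ℕ.m∸n≤m s (tot v)) (ℕ.≤-trans (ℕ.m≤n+m s m) m+s≤b)))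
               (λ a a≢ → gated-≢ (suc L) (m + s) s (a ∷ v) λ eq → a≢ (trans (sym (ℕ.m+n∸n≡m a (tot v))) (cong (_∸ tot v) eq))) ⟩
        gated (suc L) (m + s) s ((s ∸ tot v) ∷ v)
          ≡⟨ subst (λ z → gated (suc L) (m + z) z ((s ∸ tot v) ∷ v) ≡ x ^ (z * z) *ℚ i (s ∸ tot v) *ℚ gate L m v)
               (ℕ.m∸n+n≡m t≤s) (trans (gated-≡ (suc L) (m + tot ((s ∸ tot v) ∷ v)) ((s ∸ tot v) ∷ v)) (gate-∷ L m (s ∸ tot v) v)) ⟩
        x ^ (s * s) *ℚ i (s ∸ tot v) *ℚ gate L m v
          ≡⟨ ℚ.*-assoc (x ^ (s * s)) (i (s ∸ tot v)) (gate L m v) ⟩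
        x ^ (s * s) *ℚ (i (s ∸ tot v) *ℚ gate L m v)
          ≡⟨ cong (λ z → x ^ (s * s) *ℚ (i (s ∸ tot v) *ℚ z)) (gated-≡ L m v) ⟨
        x ^ (s * s) *ℚ (i (s ∸ tot v) *ℚ gated L m (tot v) v)
          ≡⟨ cong (x ^ (s * s) *ℚ_) (∑-single {f = λ j → i (s ∸ j) *ℚ gated L m j v} (s≤s t≤s) (λ j j≢t →
               trans (cong (i (s ∸ j) *ℚ_) (gated-≢ L m j v (j≢t ∘ sym))) (ℚ.*-zeroʳ (i (s ∸ j))))) ⟨
        x ^ (s * s) *ℚ ∑ (suc s) (λ j → i (s ∸ j) *ℚ gated L m j v) ∎

  vsum-gate : ∀ k b L n → n ℕ.≤ b → L ℕ.≤ k → vsum k b (gate L n) ≡ S L n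
  vsum-gate k b L n n≤b L≤k = begin
    vsum k b (gate L n)
      ≡⟨ vsum-cong k b split ⟩
    vsum k b (λ v → ∑ (suc n) λ s → gated L n s v)
      ≡⟨ vsum-∑ k b (suc n) (λ v s → gated L n s v) ⟩
    ∑ (suc n) (λ s → vsum k b (gated L n s))
      ≡⟨ ∑-cong (suc n) (λ s _ → vsum-gated k b L n s n≤b L≤k) ⟩
    S L n ∎
    where
    open ≡-Reasoning
    split : ∀ v → gate L n v ≡ ∑ (suc n) λ s → gated L n s v
    split v with tot v ℕ.≤? n
    ... | yes t≤n = trans (sym (gated-≡ L n v)) (sym (∑-single (s≤s t≤n) λ j j≢t → gated-≢ L n j v (j≢t ∘ sym)))
    ... | no  t≰n = trans (gate-> L n v (ℕ.≰⇒> t≰n))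
      (sym (∑-zero (suc n) λ { s (s≤s s≤n) → gated-≢ L n s v λ eq → t≰n (subst (ℕ._≤ n) (sym eq) s≤n) }))

-- From weights to the measure P

module Main (q : ℚ) (2≤q : fromℕ 2 ≤ q) where

  0<q : 0ℚ ℚ.< q
  0<q = ℚ.<-≤-trans (ℚ.positive⁻¹ (fromℕ 2)) 2≤q

  x : ℚ
  x = inv q

  2x≤1 : x +ℚ x ≤ 1ℚ
  2x≤1 = subst₂ _≤_ (solve 1 (λ x → con (fromℕ 2) :* x := x :+ x) refl x) (*-inv 0<q) (*-monoˡ (0≤inv 0<q) 2≤q)

  open Weights x (0<inv 0<q) 2x≤1

  0<q^ : ∀ k → 0ℚ ℚ.< q ^ k
  0<q^ = 0<^ 0<q

  poch≡φ : ∀ k → poch1/q q k ≡ φ x k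
  poch≡φ zero    = refl
  poch≡φ (suc k) = cong₂ (λ a b → a *ℚ (1ℚ - b)) (poch≡φ k) (inv-^ 0<q (suc k))

  denominator : ∀ {k} → Vec ℕ k → ℚ
  denominator v = prodℚ (toList (tabulate λ j →
    (q ^ (conj v (suc (toℕ j)) * conj v (suc (toℕ j)))) *ℚ poch1/q q (lookup v j)))

  0<factor : ∀ c a → 0ℚ ℚ.< q ^ c *ℚ poch1/q q a
  0<factor c a = 0<* (0<q^ c) (subst (0ℚ ℚ.<_) (sym (poch≡φ a)) (0<φ a))

  0<denominator : ∀ {k} (v : Vec ℕ k) → 0ℚ ℚ.< denominator v
  0<denominator []      = 0<1
  0<denominator (a ∷ v) = 0<* (0<factor (conj (a ∷ v) 1 * conj (a ∷ v) 1) a) (0<denominator v)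

  inv-denominator : ∀ {k} (v : Vec ℕ k) → inv (denominator v) ≡ wt v
  inv-denominator []      = refl
  inv-denominator (a ∷ v) = begin
    inv (q ^ (c * c) *ℚ poch1/q q a *ℚ denominator v)
      ≡⟨ inv-* (0<factor (c * c) a) (0<denominator v) ⟩
    inv (q ^ (c * c) *ℚ poch1/q q a) *ℚ inv (denominator v)
      ≡⟨ cong₂ _*ℚ_ (cong (λ z → inv (q ^ (c * c) *ℚ z)) (poch≡φ a)) (inv-denominator v) ⟩
    inv (q ^ (c * c) *ℚ φ x a) *ℚ wt v
      ≡⟨ cong (_*ℚ wt v) (trans (inv-* (0<q^ (c * c)) (0<φ a)) (cong₂ _*ℚ_ (inv-^ 0<q (c * c)) (sym (i≡inv a)))) ⟩
    x ^ (c * c) *ℚ i a *ℚ wt v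
      ≡⟨ cong (λ c → x ^ (c * c) *ℚ i a *ℚ wt v) (conj-1 (a ∷ v)) ⟩
    wt (a ∷ v) ∎
    where
    open ≡-Reasoning
    c = conj (a ∷ v) 1

  Pr≡ : ∀ n L → L ℕ.≤ n → Pr n (suc L) q ≡ q ^ n *ℚ (φ x n *ℚ S L n)
  Pr≡ n L L≤n = begin
    Pr n (suc L) q
      ≡⟨ sumℚ-allVecs n n summand ⟩
    vsum n n summand
      ≡⟨ vsum-cong n n pointwise ⟩
    vsum n n (λ v → q ^ n *ℚ φ x n *ℚ gate L n v)
      ≡⟨ vsum-* n n (q ^ n *ℚ φ x n) (gate L n) ⟩
    q ^ n *ℚ φ x n *ℚ vsum n n (gate L n)
      ≡⟨ cong (q ^ n *ℚ φ x n *ℚ_) (vsum-gate n n L n ℕ.≤-refl L≤n) ⟩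
    q ^ n *ℚ φ x n *ℚ S L n
      ≡⟨ ℚ.*-assoc (q ^ n) (φ x n) (S L n) ⟩
    q ^ n *ℚ (φ x n *ℚ S L n) ∎
    where
    open ≡-Reasoning
    summand : Vec ℕ n → ℚ
    summand v = if (size v ≡ᵇ n) ∧ (largest v <ᵇ suc L) then Pnq n q v else 0ℚ
    pointwise : ∀ v → summand v ≡ q ^ n *ℚ φ x n *ℚ gate L n v
    pointwise v = trans
      (cong (λ s → if (size v ≡ᵇ n) ∧ s then Pnq n q v else 0ℚ) (largest-small v L))
      (scale ((size v ≡ᵇ n) ∧ small v L))
      where
      scale : ∀ b → (if b then Pnq n q v else 0ℚ) ≡ q ^ n *ℚ φ x n *ℚ (if b then wt v else 0ℚ)
      scale true  = cong₂ (λ a b → q ^ n *ℚ a *ℚ b) (poch≡φ n) (inv-denominator v)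
      scale false = sym (ℚ.*-zeroʳ (q ^ n *ℚ φ x n))

  t : ℚ
  t = 1ℚ - inv q

  0<t : 0ℚ ℚ.< t
  0<t = ℚ.<-≤-trans (0<inv 0<q) x≤1-x

  inv-t : inv t ≡ u
  inv-t = inv-unique u 0<t (trans (ℚ.*-comm t u) u-eq)

  q^*x^ : ∀ n → q ^ n *ℚ x ^ n ≡ 1ℚ
  q^*x^ n = trans (cong (q ^ n *ℚ_) (sym (inv-^ 0<q n))) (*-inv (0<q^ n))

  -- The factor x^n in the bounds on `S` cancels against the q^n in the definition of P.
  q^x^-cancel : ∀ n z → q ^ n *ℚ (x ^ n *ℚ z) ≡ z
  q^x^-cancel n z = trans (sym (ℚ.*-assoc (q ^ n) (x ^ n) z)) (trans (cong (_*ℚ z) (q^*x^ n)) (ℚ.*-identityˡ z))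

  Pr-≤ : ∀ L M → let n = L + suc M in
    Pr n (suc L) q ≤ u *ℚ u *ℚ (x ^ (suc M + suc M) +ℚ x ^ suc n)
  Pr-≤ L M = subst₂ _≤_ (sym (Pr≡ n L (ℕ.m≤m+n L (suc M)))) (q^x^-cancel n _)
    (*-monoʳ (ℚ.<⇒≤ (0<q^ n)) (φS-≤ L M))
    where n = L + suc M

  Pr-≥ : ∀ L M → let n = L + suc M in
    x ^ (suc M + suc M) - u *ℚ x ^ suc n ≤ Pr n (suc L) q
  Pr-≥ L M = subst₂ _≤_ (q^x^-cancel n _) (sym (Pr≡ n L (ℕ.m≤m+n L (suc M))))
    (*-monoʳ (ℚ.<⇒≤ (0<q^ n)) (φS-≥ L (suc M) (s≤s z≤n)))
    where n = L + suc M

theorem2 : (q : ℚ) → fromℕ 2 ≤ q → (n r : ℕ) → 0 < r → r < n →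
    let t = 1ℚ - inv q in
    (Pr n r q ≤ (inv t *ℚ inv t) *ℚ (inv (q ^ (2 * n ∸ 2 * r + 2)) +ℚ inv (1ℚ - inv (q ^ (2 * n + 1))) *ℚ inv (q ^ (n + 1))))
    × (inv (q ^ (2 * n ∸ 2 * r + 2)) - inv ((q ^ (n + 1)) *ℚ t) - inv ((q ^ (2 * n ∸ 2 * r + 3)) *ℚ (t *ℚ t)) - inv ((q ^ (3 * n ∸ 3 * r + 4)) *ℚ (t *ℚ (t *ℚ t))) - inv (t *ℚ t) *ℚ inv ((q ^ (2 * n + 3)) *ℚ (1ℚ - inv (q ^ (2 * n + 3)))) ≤ Pr n r q)
theorem2 q 2≤q n (suc L) _ r<n = upper , lower
  where
  open Main q 2≤q
  open Weights x (0<inv 0<q) 2x≤1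
  -- M = n - r, so the leading exponent 2n - 2r + 2 is (M + 1) + (M + 1).
  M = n ∸ suc L
  n≡ : L + suc M ≡ n
  n≡ = trans (ℕ.+-suc L M) (ℕ.m+[n∸m]≡n (ℕ.<⇒≤ r<n))

  x^lead : inv (q ^ (2 * n ∸ 2 * suc L + 2)) ≡ x ^ (suc M + suc M)
  x^lead = trans (inv-^ 0<q (2 * n ∸ 2 * suc L + 2)) (cong (x ^_) (trans
    (cong (_+ 2) (sym (ℕ.*-distribˡ-∸ 2 n (suc L))))
    (NS.solve 1 (λ M → NS.con 2 NS.:* M NS.:+ NS.con 2 NS.:= NS.con 1 NS.:+ M NS.:+ (NS.con 1 NS.:+ M)) refl M)))

  x^n+1 : inv (q ^ (n + 1)) ≡ x ^ suc n
  x^n+1 = trans (inv-^ 0<q (n + 1)) (cong (x ^_) (ℕ.+-comm n 1))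

  0<1-inv : ∀ k → 0ℚ ℚ.< 1ℚ - inv (q ^ (2 * n + suc k))
  0<1-inv k = subst (λ z → 0ℚ ℚ.< 1ℚ - z)
    (sym (trans (inv-^ 0<q (2 * n + suc k)) (cong (x ^_) (ℕ.+-suc (2 * n) k)))) (0<1-x^suc (2 * n + k))

  upper : Pr n (suc L) q ≤ (inv t *ℚ inv t) *ℚ
    (inv (q ^ (2 * n ∸ 2 * suc L + 2)) +ℚ inv (1ℚ - inv (q ^ (2 * n + 1))) *ℚ inv (q ^ (n + 1)))
  upper = begin
    Pr n (suc L) q
      ≤⟨ subst (λ n → Pr n (suc L) q ≤ u *ℚ u *ℚ (x ^ (suc M + suc M) +ℚ x ^ suc n)) n≡ (Pr-≤ L M) ⟩
    u *ℚ u *ℚ (x ^ (suc M + suc M) +ℚ x ^ suc n)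
      ≡⟨ cong₂ (λ a b → a *ℚ a *ℚ (b +ℚ x ^ suc n)) inv-t x^lead ⟨
    inv t *ℚ inv t *ℚ (y +ℚ x ^ suc n)
      ≡⟨ cong (λ z → inv t *ℚ inv t *ℚ (y +ℚ z)) (trans (ℚ.*-identityˡ (inv (q ^ (n + 1)))) x^n+1) ⟨
    inv t *ℚ inv t *ℚ (y +ℚ 1ℚ *ℚ inv (q ^ (n + 1)))
      -- The factor 1/(1 - 1/q^(2n+1)) is at least 1.
      ≤⟨ *-monoʳ (0≤* (0≤inv 0<t) (0≤inv 0<t)) (ℚ.+-monoʳ-≤ y (*-monoˡ (0≤inv (0<q^ (n + 1)))
           (≤-inv (0<1-inv 0) (-‿≤ (inv (q ^ (2 * n + 1))) (0≤inv (0<q^ (2 * n + 1))))))) ⟩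
    inv t *ℚ inv t *ℚ (y +ℚ inv (1ℚ - inv (q ^ (2 * n + 1))) *ℚ inv (q ^ (n + 1))) ∎
    where
    open ℚ.≤-Reasoning
    y = inv (q ^ (2 * n ∸ 2 * suc L + 2))

  lower : inv (q ^ (2 * n ∸ 2 * suc L + 2)) - inv ((q ^ (n + 1)) *ℚ t) - inv ((q ^ (2 * n ∸ 2 * suc L + 3)) *ℚ (t *ℚ t))
    - inv ((q ^ (3 * n ∸ 3 * suc L + 4)) *ℚ (t *ℚ (t *ℚ t)))
    - inv (t *ℚ t) *ℚ inv ((q ^ (2 * n + 3)) *ℚ (1ℚ - inv (q ^ (2 * n + 3)))) ≤ Pr n (suc L) q
  lower = begin
    y - z - z₁ - z₂ - z₃
      -- The sharper bound `y - z` implies the claim, since `z₁`, `z₂` and `z₃` are nonnegative.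
      ≤⟨ -‿≤ z₃ (0≤* (0≤inv 0<t²) (0≤inv (0<* (0<q^ (2 * n + 3)) (0<1-inv 2)))) ⟩
    y - z - z₁ - z₂
      ≤⟨ -‿≤ z₂ (0≤inv (0<* (0<q^ (3 * n ∸ 3 * suc L + 4)) (0<* 0<t 0<t²))) ⟩
    y - z - z₁
      ≤⟨ -‿≤ z₁ (0≤inv (0<* (0<q^ (2 * n ∸ 2 * suc L + 3)) 0<t²)) ⟩
    y - z
      ≡⟨ cong₂ _-_ x^lead (trans (inv-* (0<q^ (n + 1)) 0<t)
           (trans (cong₂ _*ℚ_ x^n+1 inv-t) (ℚ.*-comm (x ^ suc n) u))) ⟩
    x ^ (suc M + suc M) - u *ℚ x ^ suc n
      ≤⟨ subst (λ n → x ^ (suc M + suc M) - u *ℚ x ^ suc n ≤ Pr n (suc L) q) n≡ (Pr-≥ L M) ⟩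
    Pr n (suc L) q ∎
    where
    open ℚ.≤-Reasoning
    y = inv (q ^ (2 * n ∸ 2 * suc L + 2))
    z = inv ((q ^ (n + 1)) *ℚ t)
    z₁ = inv ((q ^ (2 * n ∸ 2 * suc L + 3)) *ℚ (t *ℚ t))
    z₂ = inv ((q ^ (3 * n ∸ 3 * suc L + 4)) *ℚ (t *ℚ (t *ℚ t)))
    z₃ = inv (t *ℚ t) *ℚ inv ((q ^ (2 * n + 3)) *ℚ (1ℚ - inv (q ^ (2 * n + 3))))
    0<t² : 0ℚ ℚ.< t *ℚ t
    0<t² = 0<* 0<t 0<t
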